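{- Let $d\ge 2$. On the unweighted Bratteli diagram of finite $d$-ary trees (finite trees growing in the complete infinite $d$-ary tree $\mathcal S_d$), there is a unique MERW, and it is the $d$-ary search tree process, i.e. the Markov chain started from the single-vertex tree with transition probabilities $$p(\tau,\tau\sqcup\{v\})=\frac{1}{1+(d-1)|\tau|}$$ for each of the $1+(d-1)|\tau|$ nodes $v\in\mathcal S_d\setminus\tau$ such that $\tau\sqcup\{v\}$ is a $d$-ary tree.
   Context: $\mathcal S_d$ is the set of finite words over $\{1,\dots,d\}$, including the empty word $\emptyset$. A finite $d$-ary tree is a finite set $\tau\subset\mathcal S_d$ containing $\emptyset$ and closed under taking prefixes; $|\tau|$ is its cardinality. The Bratteli diagram $\mathbb X=\bigsqcup_{n\ge 0}\mathbb X_n$ has level $\mathbb X_n$ = set of $d$-ary trees of size $n+1$, root $\varnothing=\{\emptyset\}$, and an edge $\tau\nearrow\sigma$ iff $\sigma=\tau\sqcup\{v\}$ for some $v\notin\tau$. $d(\tau,\sigma)$ is the number of directed paths from $\tau$ to $\sigma$ and $d(\tau,\mathbb X_n)=\sum_{\sigma\in\mathbb X_n}d(\tau,\sigma)$. Definition of MERW: let $\varphi_n(\tau)=d(\tau,\mathbb X_n)/d(\varnothing,\mathbb X_n)$. If $\varphi^*$ is a pointwise limit of $\varphi_{n_k}$ along some subsequence $n_k\to\infty$, the associated MERW is the Markov chain started at $\varnothing$ with transition probabilities $p(\tau,\sigma)=\varphi^*(\sigma)/\varphi^*(\tau)$, $\tau\nearrow\sigma$, on $\{\varphi^*>0\}$.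 MERWs are the Markov chains arising in this way. -}

module Defs where

open import Data.Bool.Base using (if_then_else_)
open import Data.Fin.Base as Fin using (Fin)
import Data.Fin.Properties as Fin
open import Data.Integer.Base using (+_)
open import Data.List.Base hiding (find; any; all; lookup; sum)
open import Data.List.Membership.Propositional using (_∈_; _∉_; find; lose)
open import Data.List.Membership.Propositional.Properties
open import Data.List.Membership.Propositional.Properties.WithK using (unique∧set⇒bag)
import Data.List.Membership.DecPropositional as DecMembership
import Data.List.Properties as List
open import Data.List.Relation.Binary.BagAndSetEquality using (_∼[_]_; set; ∼bag⇒↭)
open import Data.List.Relation.Binary.Disjoint.Propositional using (Disjoint)
open import Data.List.Relation.Binary.Lex.Strict as Lex using (Lex-<; this; next; halt)
open import Data.List.Relation.Binary.Permutation.Propositional.Properties using (↭-length)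
open import Data.List.Relation.Binary.Pointwise using (≡⇒Pointwise-≡)
open import Data.List.Relation.Unary.All as All using (All; []; _∷_)
import Data.List.Relation.Unary.All.Properties as All
open import Data.List.Relation.Unary.AllPairs as AllPairs using (AllPairs; []; _∷_)
import Data.List.Relation.Unary.AllPairs.Properties as AllPairs
open import Data.List.Relation.Unary.Any using (Any; here; there; any?)
open import Data.List.Relation.Unary.Unique.Propositional using (Unique)
import Data.List.Relation.Unary.Unique.Propositional.Properties as Unique
import Data.List.Relation.Unary.Unique.DecPropositional.Properties as UniqueDec
open import Data.Maybe.Base using (Maybe; just; nothing)
import Data.Maybe.Properties as Maybe
open import Data.Nat.ListAction using (sum)
open import Data.Nat.Base as ℕ using (ℕ; zero; suc; _≤_; _∸_; z≤n; s≤s)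
import Data.Nat.Properties as ℕ
open import Data.Product.Base using (Σ; ∃; _×_; _,_; proj₁; proj₂)
open import Data.Rational.Base as ℚ using (ℚ; 0ℚ; 1ℚ; ½)
import Data.Rational.Properties as ℚ
open import Data.Rational.Solver using (module +-*-Solver)
open import Data.Sum.Base using (_⊎_; inj₁; inj₂)
open import Data.Unit.Base using (⊤)
open import Function.Base using (_∘_; id; flip)
open import Function.Bundles using (_⇔_; mk⇔; Equivalence)
open import Relation.Binary.Definitions using (DecidableEquality; Decidable)
open import Relation.Binary.PropositionalEquality
open import Relation.Nullary using (¬_; Dec; yes; no; does; recompute; contradiction)
open import Relation.Nullary.Decidable using (map′; _×-dec_; ¬?)

-- Real numbers, as Cauchy sequences of rationals

Cauchy : (ℕ → ℚ) → Set
Cauchy x = ∀ ε → 0ℚ ℚ.< ε → ∃ λ N → ∀ m n → N ≤ m → N ≤ n → ℚ.∣ x m ℚ.- x n ∣ ℚ.< ε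

record ℝ : Set where
  constructor real
  field
    seq    : ℕ → ℚ
    cauchy : Cauchy seq

open ℝ

infix 4 _≃_ _<ℝ_ _≤ℝ_

_≃_ : ℝ → ℝ → Set
x ≃ y = ∀ ε → 0ℚ ℚ.< ε → ∃ λ N → ∀ n → N ≤ n → ℚ.∣ seq x n ℚ.- seq y n ∣ ℚ.< ε

_<ℝ_ : ℝ → ℝ → Set
x <ℝ y = ∃ λ δ → 0ℚ ℚ.< δ × ∃ λ N → ∀ n → N ≤ n → seq x n ℚ.+ δ ℚ.≤ seq y n

_≤ℝ_ : ℝ → ℝ → Set
x ≤ℝ y = ¬ (y <ℝ x)

module ℚ-Lemmas where

  ≤-substˡ : ∀ {a b c} → b ≡ a → a ℚ.≤ c → b ℚ.≤ c
  ≤-substˡ refl h = h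

  ≤-substʳ : ∀ {a b c} → a ≡ b → c ℚ.≤ a → c ℚ.≤ b
  ≤-substʳ refl h = h

  <-substʳ : ∀ {a b c} → a ≡ b → c ℚ.< a → c ℚ.< b
  <-substʳ refl h = h

  half-pos : ∀ {ε} → 0ℚ ℚ.< ε → 0ℚ ℚ.< ε ℚ.* ½
  half-pos {ε} 0<ε = subst (ℚ._< ε ℚ.* ½) (ℚ.*-zeroˡ ½) (ℚ.*-monoˡ-<-pos ½ 0<ε)

  half+half : ∀ ε → ε ℚ.* ½ ℚ.+ ε ℚ.* ½ ≡ ε
  half+half ε = trans (sym (ℚ.*-distribˡ-+ ε ½ ½)) (ℚ.*-identityʳ ε)

  ∣∣-add : ∀ a b c d → ℚ.∣ (a ℚ.+ b) ℚ.- (c ℚ.+ d) ∣ ℚ.≤ ℚ.∣ a ℚ.- c ∣ ℚ.+ ℚ.∣ b ℚ.- d ∣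
  ∣∣-add a b c d = ≤-substˡ (cong ℚ.∣_∣ lem) (ℚ.∣p+q∣≤∣p∣+∣q∣ (a ℚ.- c) (b ℚ.- d))
    where
    open +-*-Solver
    lem : (a ℚ.+ b) ℚ.- (c ℚ.+ d) ≡ (a ℚ.- c) ℚ.+ (b ℚ.- d)
    lem = solve 4 (λ a b c d → (a :+ b) :- (c :+ d) := (a :- c) :+ (b :- d)) refl a b c d

  ∣∣-mul : ∀ a b c d → ℚ.∣ a ℚ.* b ℚ.- c ℚ.* d ∣
             ℚ.≤ ℚ.∣ a ∣ ℚ.* ℚ.∣ b ℚ.- d ∣ ℚ.+ ℚ.∣ d ∣ ℚ.* ℚ.∣ a ℚ.- c ∣
  ∣∣-mul a b c d = subst₂ (λ s t → ℚ.∣ s ∣ ℚ.≤ t) (sym lem)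
      (cong₂ ℚ._+_ (ℚ.∣p*q∣≡∣p∣*∣q∣ a (b ℚ.- d)) (ℚ.∣p*q∣≡∣p∣*∣q∣ d (a ℚ.- c)))
      (ℚ.∣p+q∣≤∣p∣+∣q∣ (a ℚ.* (b ℚ.- d)) (d ℚ.* (a ℚ.- c)))
    where
    open +-*-Solver
    lem : a ℚ.* b ℚ.- c ℚ.* d ≡ a ℚ.* (b ℚ.- d) ℚ.+ d ℚ.* (a ℚ.- c)
    lem = solve 4 (λ a b c d → a :* b :- c :* d := a :* (b :- d) :+ d :* (a :- c)) refl a b c d

  ∣∣-shift : ∀ a b → ℚ.∣ a ∣ ℚ.≤ ℚ.∣ a ℚ.- b ∣ ℚ.+ ℚ.∣ b ∣
  ∣∣-shift a b = ≤-substˡ (cong ℚ.∣_∣ (sym lem)) (ℚ.∣p+q∣≤∣p∣+∣q∣ (a ℚ.- b) b)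
    where
    open +-*-Solver
    lem : (a ℚ.- b) ℚ.+ b ≡ a
    lem = solve 2 (λ a b → (a :- b) :+ b := a) refl a b

  ∣∣-rev : ∀ a b → ℚ.∣ a ∣ ℚ.- ℚ.∣ b ∣ ℚ.≤ ℚ.∣ a ℚ.- b ∣
  ∣∣-rev a b = ≤-substʳ lem (ℚ.+-monoˡ-≤ (ℚ.- ℚ.∣ b ∣) (∣∣-shift a b))
    where
    open +-*-Solver
    lem : ℚ.∣ a ℚ.- b ∣ ℚ.+ ℚ.∣ b ∣ ℚ.- ℚ.∣ b ∣ ≡ ℚ.∣ a ℚ.- b ∣
    lem = solve 2 (λ x y → x :+ y :- y := x) refl ℚ.∣ a ℚ.- b ∣ ℚ.∣ b ∣

  ∣∣-sym : ∀ a b → ℚ.∣ a ℚ.- b ∣ ≡ ℚ.∣ b ℚ.- a ∣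
  ∣∣-sym a b = trans (sym (ℚ.∣-p∣≡∣p∣ (a ℚ.- b))) (cong ℚ.∣_∣ lem)
    where
    open +-*-Solver
    lem : ℚ.- (a ℚ.- b) ≡ b ℚ.- a
    lem = solve 2 (λ a b → :- (a :- b) := b :- a) refl a b

  ∣∣-abs : ∀ a b → ℚ.∣ ℚ.∣ a ∣ ℚ.- ℚ.∣ b ∣ ∣ ℚ.≤ ℚ.∣ a ℚ.- b ∣
  ∣∣-abs a b with ℚ.∣p∣≡p∨∣p∣≡-p (ℚ.∣ a ∣ ℚ.- ℚ.∣ b ∣)
  ... | inj₁ e = ≤-substˡ e (∣∣-rev a b)
  ... | inj₂ e = subst₂ ℚ._≤_ (trans lem (sym e)) (∣∣-sym b a) (∣∣-rev b a)
    where
    open +-*-Solver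
    lem : ℚ.∣ b ∣ ℚ.- ℚ.∣ a ∣ ≡ ℚ.- (ℚ.∣ a ∣ ℚ.- ℚ.∣ b ∣)
    lem = solve 2 (λ x y → y :- x := :- (x :- y)) refl ℚ.∣ a ∣ ℚ.∣ b ∣

  const-cauchy : ∀ q → Cauchy (λ _ → q)
  const-cauchy q ε 0<ε = 0 , λ _ _ _ _ → subst (λ t → ℚ.∣ t ∣ ℚ.< ε) (sym (ℚ.+-inverseʳ q)) 0<ε

  +-cauchy : ∀ x y → Cauchy x → Cauchy y → Cauchy (λ n → x n ℚ.+ y n)
  +-cauchy x y cx cy ε 0<ε with cx (ε ℚ.* ½) (half-pos 0<ε) | cy (ε ℚ.* ½) (half-pos 0<ε)
  ... | N , hx | M , hy = N ℕ.⊔ M , λ m n a b →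
    ℚ.≤-<-trans (∣∣-add (x m) (y m) (x n) (y n))
      (<-substʳ (half+half ε)
        (ℚ.+-mono-< (hx m n (ℕ.m⊔n≤o⇒m≤o N M a) (ℕ.m⊔n≤o⇒m≤o N M b))
                    (hy m n (ℕ.m⊔n≤o⇒n≤o N M a) (ℕ.m⊔n≤o⇒n≤o N M b))))

  neg-cauchy : ∀ x → Cauchy x → Cauchy (λ n → ℚ.- x n)
  neg-cauchy x cx ε 0<ε with cx ε 0<ε
  ... | N , h = N , λ m n a b → subst (ℚ._< ε) (sym (lem (x m) (x n))) (h m n a b)
    where
    open +-*-Solver
    lem : ∀ a b → ℚ.∣ (ℚ.- a) ℚ.- (ℚ.- b) ∣ ≡ ℚ.∣ a ℚ.- b ∣
    lem a b = trans (cong ℚ.∣_∣ (solve 2 (λ a b → (:- a) :- (:- b) := :- (a :- b)) refl a b))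
                    (ℚ.∣-p∣≡∣p∣ (a ℚ.- b))

  abs-cauchy : ∀ x → Cauchy x → Cauchy (λ n → ℚ.∣ x n ∣)
  abs-cauchy x cx ε 0<ε with cx ε 0<ε
  ... | N , h = N , λ m n a b → ℚ.≤-<-trans (∣∣-abs (x m) (x n)) (h m n a b)

  bounded : ∀ {x} → Cauchy x → ∃ λ B → 0ℚ ℚ.< B × ∃ λ N → ∀ n → N ≤ n → ℚ.∣ x n ∣ ℚ.≤ B
  bounded {x} cx with cx 1ℚ (ℚ.positive⁻¹ 1ℚ)
  ... | N , h = 1ℚ ℚ.+ ℚ.∣ x N ∣
              , ℚ.<-≤-trans (ℚ.positive⁻¹ 1ℚ)
                  (subst (ℚ._≤ 1ℚ ℚ.+ ℚ.∣ x N ∣) (ℚ.+-identityʳ 1ℚ)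
                    (ℚ.+-monoʳ-≤ 1ℚ (ℚ.0≤∣p∣ (x N))))
              , N , λ n a → ℚ.≤-trans (∣∣-shift (x n) (x N))
                  (ℚ.+-monoˡ-≤ ℚ.∣ x N ∣ (ℚ.<⇒≤ (h n N a ℕ.≤-refl)))

  scaled : ∀ B ε → 0ℚ ℚ.< B → 0ℚ ℚ.< ε → ∃ λ δ → 0ℚ ℚ.< δ × B ℚ.* δ ≡ ε
  scaled B ε 0<B 0<ε = (ℚ.1/ B) ℚ.* ε
                     , subst (ℚ._< (ℚ.1/ B) ℚ.* ε) (ℚ.*-zeroʳ (ℚ.1/ B)) (ℚ.*-monoʳ-<-pos (ℚ.1/ B) 0<ε)
                     , trans (sym (ℚ.*-assoc B (ℚ.1/ B) ε))
                         (trans (cong (ℚ._* ε) (ℚ.*-inverseʳ B)) (ℚ.*-identityˡ ε))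
    where
    instance
      pB  = ℚ.positive 0<B
      nzB = ℚ.pos⇒nonZero B
      piB = ℚ.1/pos⇒pos B

  bound-* : ∀ B u v δ → 0ℚ ℚ.< B → ℚ.∣ u ∣ ℚ.≤ B → ℚ.∣ v ∣ ℚ.< δ → ℚ.∣ u ∣ ℚ.* ℚ.∣ v ∣ ℚ.< B ℚ.* δ
  bound-* B u v δ 0<B u≤B v<δ =
    ℚ.≤-<-trans (ℚ.*-monoʳ-≤-nonNeg ℚ.∣ v ∣ u≤B) (ℚ.*-monoʳ-<-pos B v<δ)
    where
    instance
      pB = ℚ.positive 0<B
      nv = ℚ.∣-∣-nonNeg v

  *-cauchy : ∀ x y → Cauchy x → Cauchy y → Cauchy (λ n → x n ℚ.* y n)
  *-cauchy x y cx cy ε 0<ε = (N₁ ℕ.⊔ N₂) ℕ.⊔ (N₃ ℕ.⊔ N₄) , close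
    where
    bx = bounded cx
    by = bounded cy
    B = proj₁ bx
    C = proj₁ by
    0<B = proj₁ (proj₂ bx)
    0<C = proj₁ (proj₂ by)
    N₁ = proj₁ (proj₂ (proj₂ bx))
    N₂ = proj₁ (proj₂ (proj₂ by))
    sδ = scaled B (ε ℚ.* ½) 0<B (half-pos 0<ε)
    sγ = scaled C (ε ℚ.* ½) 0<C (half-pos 0<ε)
    δ = proj₁ sδ
    γ = proj₁ sγ
    my = cy δ (proj₁ (proj₂ sδ))
    mx = cx γ (proj₁ (proj₂ sγ))
    N₃ = proj₁ my
    N₄ = proj₁ mx
    l₁ : ∀ {k} → (N₁ ℕ.⊔ N₂) ℕ.⊔ (N₃ ℕ.⊔ N₄) ≤ k → N₁ ≤ k
    l₁ = ℕ.m⊔n≤o⇒m≤o N₁ N₂ ∘ ℕ.m⊔n≤o⇒m≤o (N₁ ℕ.⊔ N₂) (N₃ ℕ.⊔ N₄)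
    l₂ : ∀ {k} → (N₁ ℕ.⊔ N₂) ℕ.⊔ (N₃ ℕ.⊔ N₄) ≤ k → N₂ ≤ k
    l₂ = ℕ.m⊔n≤o⇒n≤o N₁ N₂ ∘ ℕ.m⊔n≤o⇒m≤o (N₁ ℕ.⊔ N₂) (N₃ ℕ.⊔ N₄)
    l₃ : ∀ {k} → (N₁ ℕ.⊔ N₂) ℕ.⊔ (N₃ ℕ.⊔ N₄) ≤ k → N₃ ≤ k
    l₃ = ℕ.m⊔n≤o⇒m≤o N₃ N₄ ∘ ℕ.m⊔n≤o⇒n≤o (N₁ ℕ.⊔ N₂) (N₃ ℕ.⊔ N₄)
    l₄ : ∀ {k} → (N₁ ℕ.⊔ N₂) ℕ.⊔ (N₃ ℕ.⊔ N₄) ≤ k → N₄ ≤ k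
    l₄ = ℕ.m⊔n≤o⇒n≤o N₃ N₄ ∘ ℕ.m⊔n≤o⇒n≤o (N₁ ℕ.⊔ N₂) (N₃ ℕ.⊔ N₄)
    split : B ℚ.* δ ℚ.+ C ℚ.* γ ≡ ε
    split = trans (cong₂ ℚ._+_ (proj₂ (proj₂ sδ)) (proj₂ (proj₂ sγ))) (half+half ε)
    close : ∀ m n → (N₁ ℕ.⊔ N₂) ℕ.⊔ (N₃ ℕ.⊔ N₄) ≤ m → (N₁ ℕ.⊔ N₂) ℕ.⊔ (N₃ ℕ.⊔ N₄) ≤ n →
            ℚ.∣ x m ℚ.* y m ℚ.- x n ℚ.* y n ∣ ℚ.< ε
    close m n a b = <-substʳ split (ℚ.≤-<-trans (∣∣-mul (x m) (y m) (x n) (y n)) (ℚ.+-mono-< below₁ below₂))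
      where
      below₁ : ℚ.∣ x m ∣ ℚ.* ℚ.∣ y m ℚ.- y n ∣ ℚ.< B ℚ.* δ
      below₁ = bound-* B (x m) (y m ℚ.- y n) δ 0<B (proj₂ (proj₂ (proj₂ bx)) m (l₁ a)) (proj₂ my m n (l₃ a) (l₃ b))
      below₂ : ℚ.∣ y n ∣ ℚ.* ℚ.∣ x m ℚ.- x n ∣ ℚ.< C ℚ.* γ
      below₂ = bound-* C (y n) (x m ℚ.- x n) γ 0<C (proj₂ (proj₂ (proj₂ by)) n (l₂ b)) (proj₂ mx m n (l₄ a) (l₄ b))

  above⇒nonZero : ∀ {δ q} → 0ℚ ℚ.< δ → 0ℚ ℚ.+ δ ℚ.≤ q → ℚ.NonZero q
  above⇒nonZero {δ} 0<δ h =
    ℚ.>-nonZero (ℚ.<-≤-trans 0<δ (subst (ℚ._≤ _) (ℚ.+-identityˡ δ) h))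

  -- ∣1/a - 1/b∣ = (1/a) (1/b) ∣b - a∣ ≤ (1/δ)² ∣a - b∣ for a, b ≥ δ > 0.
  inv-lipschitz : ∀ {δ} (0<δ : 0ℚ ℚ.< δ) a b (ha : 0ℚ ℚ.+ δ ℚ.≤ a) (hb : 0ℚ ℚ.+ δ ℚ.≤ b) →
    let C = (ℚ.1/ δ) {{ℚ.>-nonZero 0<δ}} in
    ℚ.∣ (ℚ.1/ a) {{above⇒nonZero 0<δ ha}} ℚ.- (ℚ.1/ b) {{above⇒nonZero 0<δ hb}} ∣
      ℚ.≤ C ℚ.* (C ℚ.* ℚ.∣ a ℚ.- b ∣)
  inv-lipschitz {δ} 0<δ a b ha hb =
    subst (ℚ._≤ C ℚ.* (C ℚ.* X)) (sym eq)
      (ℚ.≤-trans (ℚ.*-monoʳ-≤-nonNeg (ib ℚ.* X) (below ha))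
        (ℚ.*-monoˡ-≤-nonNeg C (ℚ.*-monoʳ-≤-nonNeg X (below hb))))
    where
    instance
      pδ  = ℚ.positive 0<δ
      nzδ = ℚ.>-nonZero 0<δ
      nza = above⇒nonZero 0<δ ha
      nzb = above⇒nonZero 0<δ hb
    pos : ∀ {q} → 0ℚ ℚ.+ δ ℚ.≤ q → ℚ.Positive q
    pos h = ℚ.positive (ℚ.<-≤-trans 0<δ (subst (ℚ._≤ _) (ℚ.+-identityˡ δ) h))
    C  = ℚ.1/ δ
    ia = ℚ.1/ a
    ib = ℚ.1/ b
    X  = ℚ.∣ a ℚ.- b ∣
    instance
      nX  = ℚ.∣-∣-nonNeg (a ℚ.- b)
      pC  = ℚ.1/pos⇒pos δ
      nC  = ℚ.pos⇒nonNeg C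
      pia = ℚ.1/pos⇒pos a {{pos ha}}
      nia = ℚ.pos⇒nonNeg ia
      pib = ℚ.1/pos⇒pos b {{pos hb}}
      nib = ℚ.pos⇒nonNeg ib
      nibX = ℚ.nonNeg*nonNeg⇒nonNeg ib X
    below : ∀ {q} (h : 0ℚ ℚ.+ δ ℚ.≤ q) → (ℚ.1/ q) {{above⇒nonZero 0<δ h}} ℚ.≤ C
    below {q} h = subst₂ ℚ._≤_ lem₁ lem₂ (ℚ.*-monoˡ-≤-nonNeg (C ℚ.* iq)
                    (subst (ℚ._≤ q) (ℚ.+-identityˡ δ) h))
      where
      instance
        nzq = above⇒nonZero 0<δ h
      iq = ℚ.1/ q
      instance
        piq = ℚ.1/pos⇒pos q {{pos h}}
        niq = ℚ.pos⇒nonNeg iq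
        nCq = ℚ.nonNeg*nonNeg⇒nonNeg C iq
      open +-*-Solver
      lem₁ : C ℚ.* iq ℚ.* δ ≡ iq
      lem₁ = trans (solve 3 (λ c i d → c :* i :* d := (c :* d) :* i) refl C iq δ)
               (trans (cong (ℚ._* iq) (ℚ.*-inverseˡ δ)) (ℚ.*-identityˡ iq))
      lem₂ : C ℚ.* iq ℚ.* q ≡ C
      lem₂ = trans (ℚ.*-assoc C iq q)
               (trans (cong (C ℚ.*_) (ℚ.*-inverseˡ q)) (ℚ.*-identityʳ C))
    open +-*-Solver
    eq₀ : ia ℚ.- ib ≡ ia ℚ.* (ib ℚ.* (b ℚ.- a))
    eq₀ = trans (sym (cong₂ ℚ._-_
                  (trans (cong (ia ℚ.*_) (ℚ.*-inverseˡ b)) (ℚ.*-identityʳ ia))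
                  (trans (cong (ib ℚ.*_) (ℚ.*-inverseˡ a)) (ℚ.*-identityʳ ib))))
            (solve 4 (λ i j a b → i :* (j :* b) :- j :* (i :* a) := i :* (j :* (b :- a)))
               refl ia ib a b)
    eq : ℚ.∣ ia ℚ.- ib ∣ ≡ ia ℚ.* (ib ℚ.* X)
    eq = trans (cong ℚ.∣_∣ eq₀) (trans (ℚ.∣p*q∣≡∣p∣*∣q∣ ia _)
           (cong₂ ℚ._*_ (ℚ.0≤p⇒∣p∣≡p (ℚ.nonNegative⁻¹ ia))
             (trans (ℚ.∣p*q∣≡∣p∣*∣q∣ ib _)
               (cong₂ ℚ._*_ (ℚ.0≤p⇒∣p∣≡p (ℚ.nonNegative⁻¹ ib)) (∣∣-sym b a)))))

open ℚ-Lemmas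

fromℚ : ℚ → ℝ
fromℚ q = real (λ _ → q) (const-cauchy q)

0ℝ 1ℝ : ℝ
0ℝ = fromℚ 0ℚ
1ℝ = fromℚ 1ℚ

infixl 6 _+ℝ_ _-ℝ_
infixl 7 _*ℝ_

_+ℝ_ : ℝ → ℝ → ℝ
real x cx +ℝ real y cy = real (λ n → x n ℚ.+ y n) (+-cauchy x y cx cy)

-ℝ_ : ℝ → ℝ
-ℝ real x cx = real (λ n → ℚ.- x n) (neg-cauchy x cx)

_-ℝ_ : ℝ → ℝ → ℝ
x -ℝ y = x +ℝ (-ℝ y)

_*ℝ_ : ℝ → ℝ → ℝ
real x cx *ℝ real y cy = real (λ n → x n ℚ.* y n) (*-cauchy x y cx cy)

∣_∣ℝ : ℝ → ℝ
∣ real x cx ∣ℝ = real (λ n → ℚ.∣ x n ∣) (abs-cauchy x cx)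

-- The reciprocal sequence starts at the index from which positivity
-- witnesses that the terms stay away from zero.
inv : (x : ℝ) → 0ℝ <ℝ x → ℝ
inv (real x cx) (δ , 0<δ , N , h) = real y cy
  where
  ge : ∀ n → 0ℚ ℚ.+ δ ℚ.≤ x (N ℕ.+ n)
  ge n = h (N ℕ.+ n) (ℕ.m≤m+n N n)
  y : ℕ → ℚ
  y n = (ℚ.1/ x (N ℕ.+ n)) {{above⇒nonZero 0<δ (ge n)}}
  C : ℚ
  C = (ℚ.1/ δ) {{ℚ.>-nonZero 0<δ}}
  0<C : 0ℚ ℚ.< C
  0<C = ℚ.positive⁻¹ C {{ℚ.1/pos⇒pos δ {{ℚ.positive 0<δ}}}}
  cy : Cauchy y
  cy ε 0<ε with scaled C ε 0<C 0<ε
  ... | ε₁ , 0<ε₁ , e₁ with scaled C ε₁ 0<C 0<ε₁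
  ... | ε₂ , 0<ε₂ , e₂ with cx ε₂ 0<ε₂
  ... | M , hM = M , λ m n a b →
    ℚ.≤-<-trans (inv-lipschitz 0<δ (x (N ℕ.+ m)) (x (N ℕ.+ n)) (ge m) (ge n))
      (<-substʳ (trans (cong (C ℚ.*_) e₂) e₁)
        (ℚ.*-monoʳ-<-pos C {{ℚ.positive 0<C}} (ℚ.*-monoʳ-<-pos C {{ℚ.positive 0<C}}
          (hM (N ℕ.+ m) (N ℕ.+ n) (ℕ.≤-trans a (ℕ.m≤n+m m N)) (ℕ.≤-trans b (ℕ.m≤n+m n N))))))

divide : (x y : ℝ) → 0ℝ <ℝ y → ℝ
divide x y 0<y = x *ℝ inv y 0<y

sumℝ : List ℝ → ℝ
sumℝ = foldr _+ℝ_ 0ℝ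

infix 4 _⟶_

_⟶_ : (ℕ → ℚ) → ℝ → Set
q ⟶ x = ∀ ε → 0ℚ ℚ.< ε → ∃ λ K → ∀ k → K ≤ k → ∣ fromℚ (q k) -ℝ x ∣ℝ <ℝ fromℚ ε

module DAryTrees (d : ℕ) (2≤d : 2 ≤ d) where

  Word : Set
  Word = List (Fin d)

  infix 4 _≺_

  _≺_ : Word → Word → Set
  _≺_ = Lex-< _≡_ Fin._<_

  ≺-trans : ∀ {u v w} → u ≺ v → v ≺ w → u ≺ w
  ≺-trans = Lex.<-transitive isEquivalence (resp₂ Fin._<_) Fin.<-trans

  ≺-irrefl : ∀ {u} → ¬ (u ≺ u)
  ≺-irrefl = Lex.<-irreflexive Fin.<-irrefl (≡⇒Pointwise-≡ refl)

  _≺?_ : Decidable _≺_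
  _≺?_ = Lex.<-decidable Fin._≟_ Fin._<?_

  _≟ʷ_ : DecidableEquality Word
  _≟ʷ_ = List.≡-dec Fin._≟_

  open DecMembership _≟ʷ_ using (_∈?_)

  -- A finite set of words is stored as its list of elements in strictly
  -- decreasing lexicographic order, so that equal sets are equal lists.
  record Tree : Set where
    constructor tree
    field
      nodes   : List Word
      .sorted : AllPairs (flip _≺_) nodes
      .root∈  : [] ∈ nodes
      .closed : ∀ u v → u ++ v ∈ nodes → u ∈ nodes

  open Tree public using (nodes)

  size : Tree → ℕ
  size τ = length (nodes τ)

  root : Tree
  root = tree ([] ∷ []) ([] ∷ []) (here refl) λ where
    []      v p         → here refl
    (_ ∷ _) v (here ())
    (_ ∷ _) v (there ())

  Adjoins : Tree → Word → Tree → Set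
  Adjoins τ v σ = v ∉ nodes τ × nodes σ ∼[ set ] (v ∷ nodes τ)

  infix 4 _↗_

  _↗_ : Tree → Tree → Set
  τ ↗ σ = ∃ λ v → Adjoins τ v σ

  -- Edges are irrelevant, so a path is determined by its vertices.
  data Path : Tree → Tree → Set where
    []  : ∀ {τ} → Path τ τ
    _∷_ : ∀ {τ τ′ σ} → .(τ ↗ τ′) → Path τ′ σ → Path τ σ

  sorted : ∀ τ → AllPairs (flip _≺_) (nodes τ)
  sorted (tree ns s _ _) = recompute (AllPairs.allPairs? (flip _≺?_) ns) s

  root∈ : ∀ τ → [] ∈ nodes τ
  root∈ (tree ns _ r _) = recompute ([] ∈? ns) r

  closed : ∀ τ u v → u ++ v ∈ nodes τ → u ∈ nodes τ
  closed (tree ns _ _ c) u v p = recompute (u ∈? ns) (c u v p)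

  unique-nodes : ∀ τ → Unique (nodes τ)
  unique-nodes τ = AllPairs.map (λ { p refl → ≺-irrefl p }) (sorted τ)

  nodes-injective : ∀ {τ σ} → nodes τ ≡ nodes σ → τ ≡ σ
  nodes-injective refl = refl

  _≟_ : DecidableEquality Tree
  τ ≟ σ = map′ nodes-injective (cong nodes) (List.≡-dec _≟ʷ_ (nodes τ) (nodes σ))

  set-injective : ∀ {τ σ} → nodes τ ∼[ set ] nodes σ → τ ≡ σ
  set-injective {τ} {σ} eq = nodes-injective (go (sorted τ) (sorted σ) (to eq) (from eq))
    where
    to : ∀ {xs ys : List Word} → xs ∼[ set ] ys → ∀ {w} → w ∈ xs → w ∈ ys
    to e = Equivalence.to e
    from : ∀ {xs ys : List Word} → xs ∼[ set ] ys → ∀ {w} → w ∈ ys → w ∈ xs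
    from e = Equivalence.from e
    go : ∀ {xs ys} → AllPairs (flip _≺_) xs → AllPairs (flip _≺_) ys →
         (∀ {w} → w ∈ xs → w ∈ ys) → (∀ {w} → w ∈ ys → w ∈ xs) → xs ≡ ys
    go [] [] f g = refl
    go [] (_ ∷ _) f g with () ← g (here refl)
    go (_ ∷ _) [] f g with () ← f (here refl)
    go {x ∷ xs} {y ∷ ys} (px ∷ sx) (py ∷ sy) f g = cong₂ _∷_ x≡y (go sx sy f′ g′)
      where
      x≡y : x ≡ y
      x≡y with f (here refl) | g (here refl)
      ... | here e | _ = e
      ... | there _ | here e = sym e
      ... | there p | there q = contradiction (≺-trans (All.lookup py p) (All.lookup px q)) ≺-irrefl
      f′ : ∀ {w} → w ∈ xs → w ∈ ys
      f′ p with f (there p)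
      ... | there q = q
      ... | here refl = contradiction (subst (_ ≺_) x≡y (All.lookup px p)) ≺-irrefl
      g′ : ∀ {w} → w ∈ ys → w ∈ xs
      g′ p with g (there p)
      ... | there q = q
      ... | here refl = contradiction (subst (_ ≺_) (sym x≡y) (All.lookup py p)) ≺-irrefl

  adjoins? : ∀ τ v σ → Dec (Adjoins τ v σ)
  adjoins? τ v σ = ¬? (v ∈? nodes τ) ×-dec
    map′ (λ { (p , q) → mk⇔ (All.lookup p) (All.lookup q) })
         (λ e → All.tabulate (Equivalence.to e) , All.tabulate (Equivalence.from e))
         (All.all? (_∈? (v ∷ nodes τ)) (nodes σ) ×-dec All.all? (_∈? nodes σ) (v ∷ nodes τ))

  _↗?_ : Decidable _↗_
  τ ↗? σ = map′ (λ a → let v , _ , p = find a in v , p)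
                (λ { (v , v∉ , e) → lose {P = λ v → Adjoins τ v σ} (Equivalence.from e (here refl)) (v∉ , e) })
                (any? (λ v → adjoins? τ v σ) (nodes σ))

  ↗-size : ∀ {τ σ} → τ ↗ σ → size σ ≡ suc (size τ)
  ↗-size {τ} {σ} (v , v∉ , e) =
    ↭-length (∼bag⇒↭ (unique∧set⇒bag (unique-nodes σ)
      (All.tabulate (λ { p refl → v∉ p }) ∷ unique-nodes τ) e))

  concatMap-unique : ∀ {A B : Set} (f : A → List B) {xs} → Unique xs →
    (∀ x → Unique (f x)) → (∀ {x y b} → b ∈ f x → b ∈ f y → x ≡ y) →
    Unique (concatMap f xs)
  concatMap-unique f {xs} u uf dis =
    Unique.concat⁺ (All.map⁺ (All.universal uf xs))
      (AllPairs.map⁺ (AllPairs.map disjoint u))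
    where
    disjoint : ∀ {x y} → x ≢ y → Disjoint (f x) (f y)
    disjoint x≢y (p , q) = x≢y (dis p q)

  -- Lexicographically, every proper prefix precedes its extensions, so the
  -- head of the node list is a leaf and removing it leaves a tree.
  prefix-⊀ : ∀ u v → ¬ (u ++ v ≺ u)
  prefix-⊀ (x ∷ u) v (this x<x)  = Fin.<-irrefl refl x<x
  prefix-⊀ (x ∷ u) v (next _ p) = prefix-⊀ u v p
  prefix-⊀ [] v = Lex.xs≮[]

  prefix-snoc : ∀ u w x (i : Fin d) → u ++ w ≡ x ∷ʳ i → u ≡ x ∷ʳ i ⊎ ∃ λ w′ → u ++ w′ ≡ x
  prefix-snoc u w x i e with initLast w
  ... | [] = inj₁ (trans (sym (List.++-identityʳ u)) e)
  ... | w′ ∷ʳ′ j = inj₂ (w′ , List.∷ʳ-injectiveˡ (u ++ w′) x (trans (List.++-assoc u w′ (j ∷ [])) e))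

  Fits : Tree → Word → Set
  Fits τ v = Any (λ u → Any (λ i → v ≡ u ∷ʳ i) (allFin d)) (nodes τ) × All (_≺ v) (nodes τ)

  fits? : ∀ τ v → Dec (Fits τ v)
  fits? τ v = any? (λ u → any? (λ i → v ≟ʷ (u ∷ʳ i)) (allFin d)) (nodes τ) ×-dec All.all? (_≺? v) (nodes τ)

  cons : ∀ τ v → Fits τ v → Tree
  cons τ v (a , s) = tree (v ∷ nodes τ) (s ∷ sorted τ) (there (root∈ τ)) cl
    where
    cl : ∀ u w → u ++ w ∈ v ∷ nodes τ → u ∈ v ∷ nodes τ
    cl u w (there p) = there (closed τ u w p)
    cl u w (here e) with find a
    ... | x , x∈ , b with find b
    ... | i , _ , refl with prefix-snoc u w x i e
    ... | inj₁ eq = here eq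
    ... | inj₂ (w′ , eq) = there (closed τ u w′ (subst (_∈ nodes τ) (sym eq) x∈))

  consAll : ∀ τ v → Dec (Fits τ v) → List Tree
  consAll τ v (yes f) = cons τ v f ∷ []
  consAll τ v (no _)  = []

  grow : Tree → List Tree
  grow τ = concatMap (λ v → consAll τ v (fits? τ v)) (cartesianProductWith _∷ʳ_ (nodes τ) (allFin d))

  -- The level 𝕏ₙ, listed without repetition.
  level : ℕ → List Tree
  level zero    = root ∷ []
  level (suc n) = deduplicate _≟_ (concatMap grow (level n))

  level-unique : ∀ n → Unique (level n)
  level-unique zero    = [] ∷ []
  level-unique (suc n) = UniqueDec.deduplicate-! _≟_ _

  level-sound : ∀ n {σ} → σ ∈ level n → size σ ≡ suc n
  level-sound zero (here refl) = refl
  level-sound (suc n) {σ} p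
    with find (∈-concatMap⁻ grow {xs = level n} (∈-deduplicate⁻ _≟_ (concatMap grow (level n)) p))
  ... | τ , τ∈ , q
    with find (∈-concatMap⁻ (λ v → consAll τ v (fits? τ v))
                {xs = cartesianProductWith _∷ʳ_ (nodes τ) (allFin d)} q)
  ... | v , _ , r with fits? τ v | r
  ... | yes f | here refl = cong suc (level-sound n τ∈)

  detach : ∀ σ {n} → size σ ≡ suc (suc n) →
    ∃ λ τ → ∃ λ v → Σ (Fits τ v) λ f → σ ≡ cons τ v f
  detach σ@(tree (v ∷ w ∷ ns) _ _ _) _ = τ , v , (par , v≻) , refl
    where
    v≻ : All (_≺ v) (w ∷ ns)
    v≻ = AllPairs.head (sorted σ)
    r : [] ∈ w ∷ ns
    r with root∈ σ
    ... | there p = p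
    ... | here refl = contradiction (All.head v≻) Lex.xs≮[]
    cl : ∀ u x → u ++ x ∈ w ∷ ns → u ∈ w ∷ ns
    cl u x p with closed σ u x (there p)
    ... | there q   = q
    ... | here refl = contradiction (All.lookup v≻ p) (prefix-⊀ v x)
    τ : Tree
    τ = tree (w ∷ ns) (AllPairs.tail (sorted σ)) r cl
    par : Any (λ u → Any (λ i → v ≡ u ∷ʳ i) (allFin d)) (w ∷ ns)
    par with initLast v
    ... | [] = contradiction (All.head v≻) Lex.xs≮[]
    ... | u ∷ʳ′ i with closed σ u (i ∷ []) (here refl)
    ... | there q = lose q (lose (∈-allFin i) refl)
    ... | here e with () ← List.++-identityʳ-unique u e

  level-complete : ∀ n {σ} → size σ ≡ suc n → σ ∈ level n
  level-complete zero {σ} eq = here (lem σ eq)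
    where
    lem : ∀ σ → size σ ≡ 1 → σ ≡ root
    lem σ@(tree (v ∷ []) _ _ _) _ with root∈ σ
    ... | here refl = refl
  level-complete (suc n) {σ} eq with detach σ eq
  ... | τ , v , f , refl =
    ∈-deduplicate⁺ _≟_ (∈-concatMap⁺ grow {xs = level n}
      (lose (level-complete n {τ} (ℕ.suc-injective eq))
        (∈-concatMap⁺ (λ v → consAll τ v (fits? τ v)) {xs = cartesianProductWith _∷ʳ_ (nodes τ) (allFin d)} (lose v∈ (lem (fits? τ v))))))
    where
    v∈ : v ∈ cartesianProductWith _∷ʳ_ (nodes τ) (allFin d)
    v∈ with find (proj₁ f)
    ... | u , u∈ , b with find b
    ... | i , i∈ , refl = ∈-cartesianProductWith⁺ _∷ʳ_ u∈ i∈
    lem : (D : Dec (Fits τ v)) → cons τ v f ∈ consAll τ v D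
    lem (yes g) = here refl
    lem (no ¬f) = contradiction f ¬f

  via : ∀ τ τ′ {σ} → Dec (τ ↗ τ′) → List (Path τ′ σ) → List (Path τ σ)
  via τ τ′ {σ} (yes e) ps = map (λ (p : Path τ′ σ) → e ∷ p) ps
  via _ _ (no _)  _  = []

  trivial : ∀ {τ σ} → Dec (τ ≡ σ) → List (Path τ σ)
  trivial (yes refl) = [] ∷ []
  trivial (no _)     = []

  pathsOfLength : ℕ → ∀ τ σ → List (Path τ σ)
  pathsOfLength zero    τ σ = trivial (τ ≟ σ)
  pathsOfLength (suc k) τ σ =
    concatMap (λ τ′ → via τ τ′ (τ ↗? τ′) (pathsOfLength k τ′ σ)) (level (size τ))

  -- Each edge adds one node, so size σ ∸ size τ is the only possible length.
  paths : ∀ τ σ → List (Path τ σ)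
  paths τ σ = pathsOfLength (size σ ∸ size τ) τ σ

  pathLength : ∀ {τ σ} → Path τ σ → ℕ
  pathLength []      = 0
  pathLength (_ ∷ p) = suc (pathLength p)

  path-size : ∀ {τ σ} (p : Path τ σ) → size σ ≡ pathLength p ℕ.+ size τ
  path-size [] = refl
  path-size (_∷_ {τ} {τ′} e p) = trans (path-size p)
    (trans (cong (pathLength p ℕ.+_) (↗-size {τ} {τ′} (recompute (τ ↗? τ′) e))) (ℕ.+-suc (pathLength p) (size τ)))

  ∈-pathsOfLength : ∀ {τ σ} (p : Path τ σ) → p ∈ pathsOfLength (pathLength p) τ σ
  ∈-pathsOfLength {τ} [] = lem (τ ≟ τ)
    where
    lem : (D : Dec (τ ≡ τ)) → [] ∈ trivial D
    lem (yes refl) = here refl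
    lem (no ne)    = contradiction refl ne
  ∈-pathsOfLength {τ} {σ} (_∷_ {τ′ = τ′} e p) =
    ∈-concatMap⁺ (λ τ′ → via τ τ′ (τ ↗? τ′) (pathsOfLength (pathLength p) τ′ σ)) {xs = level (size τ)}
      (lose (level-complete (size τ) {τ′} (↗-size {τ} {τ′} e′)) (lem (τ ↗? τ′)))
    where
    e′ : τ ↗ τ′
    e′ = recompute (τ ↗? τ′) e
    lem : (D : Dec (τ ↗ τ′)) → (e ∷ p) ∈ via τ τ′ D (pathsOfLength (pathLength p) τ′ σ)
    lem (yes _) = ∈-map⁺ (λ (p : Path τ′ σ) → e ∷ p) (∈-pathsOfLength p)
    lem (no ¬e) = contradiction e′ ¬e

  paths-complete : ∀ {τ σ} (p : Path τ σ) → p ∈ paths τ σ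
  paths-complete {τ} {σ} p = subst (λ k → p ∈ pathsOfLength k τ σ) (sym len) (∈-pathsOfLength p)
    where
    len : size σ ∸ size τ ≡ pathLength p
    len = trans (cong (_∸ size τ) (path-size p)) (ℕ.m+n∸n≡m (pathLength p) (size τ))

  second : ∀ {τ σ} → Path τ σ → Maybe Tree
  second []                = nothing
  second (_∷_ {τ′ = τ′} _ _) = just τ′

  pathsOfLength-unique : ∀ k τ σ → Unique (pathsOfLength k τ σ)
  pathsOfLength-unique zero τ σ = lem (τ ≟ σ)
    where
    lem : ∀ {σ} (D : Dec (τ ≡ σ)) → Unique (trivial D)
    lem (yes refl) = [] ∷ []
    lem (no _)     = []
  pathsOfLength-unique (suc k) τ σ =
    concatMap-unique (λ τ′ → via τ τ′ (τ ↗? τ′) (pathsOfLength k τ′ σ)) (level-unique (size τ))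
      (λ τ′ → lem (τ ↗? τ′) (pathsOfLength-unique k τ′ σ))
      (λ {x} {y} p q → Maybe.just-injective (trans (sym (sec x (τ ↗? x) p)) (sec y (τ ↗? y) q)))
    where
    lem : ∀ {τ′ ps} (D : Dec (τ ↗ τ′)) → Unique ps → Unique (via τ τ′ {σ} D ps)
    lem {τ′} (yes e) u = Unique.map⁺ {f = λ (p : Path τ′ σ) → e ∷ p} (λ { refl → refl }) u
    lem (no _)  u = []
    sec : ∀ τ′ {ps} {p : Path τ σ} (D : Dec (τ ↗ τ′)) → p ∈ via τ τ′ D ps → second p ≡ just τ′
    sec τ′ (yes e) q with ∈-map⁻ (λ (p : Path τ′ σ) → e ∷ p) q
    ... | _ , _ , refl = refl

  paths-unique : ∀ τ σ → Unique (paths τ σ)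
  paths-unique τ σ = pathsOfLength-unique (size σ ∸ size τ) τ σ

  #paths : Tree → Tree → ℕ
  #paths τ σ = length (paths τ σ)

  #pathsTo : Tree → ℕ → ℕ
  #pathsTo τ n = sum (map (#paths τ) (level n))

  Addable : Tree → Word → Set
  Addable τ v = ∃ λ σ → Adjoins τ v σ

  NumberOf : (Word → Set) → ℕ → Set
  NumberOf P k = ∃ λ ws → Unique ws × (∀ v → v ∈ ws ⇔ P v) × length ws ≡ k

  -- Transition probabilities are indexed by a proof that the starting point
  -- is a state; the laws they must satisfy are in IsMarkovChain.
  record Chain : Set₁ where
    field
      State : Tree → Set
      start : Tree
      p     : ∀ τ (σ : Tree) → State τ → ℝ

  -- Sums over level (size τ) are sums over all possible targets, because an
  -- edge out of τ leads to a tree with size τ + 1 nodes.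
  record IsMarkovChain (C : Chain) : Set where
    open Chain C
    field
      start∈State : State start
      p-nonneg    : ∀ τ σ s → 0ℝ ≤ℝ p τ σ s
      p-edges     : ∀ τ σ s → ¬ (τ ↗ σ) → p τ σ s ≃ 0ℝ
      p-states    : ∀ τ σ s → ¬ State σ → p τ σ s ≃ 0ℝ
      p-total     : ∀ τ s → sumℝ (map (λ σ → p τ σ s) (level (size τ))) ≃ 1ℝ

  infix 4 _≈_

  record _≈_ (C D : Chain) : Set where
    private
      module C = Chain C
      module D = Chain D
    field
      states : ∀ τ → C.State τ ⇔ D.State τ
      starts : C.start ≡ D.start
      probs  : ∀ τ σ s t → C.p τ σ s ≃ D.p τ σ t

  onEdge : Tree → Tree → ℝ → ℝ
  onEdge τ σ x = if does (τ ↗? σ) then x else 0ℝ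

  searchTree : Chain
  searchTree = record
    { State = λ _ → ⊤
    ; start = root
    ; p     = λ τ σ _ → onEdge τ σ (fromℚ ((+ 1) ℚ./ (1 ℕ.+ (d ∸ 1) ℕ.* size τ)))
    }

  ratioChain : (Tree → ℝ) → Chain
  ratioChain φ* = record
    { State = λ τ → 0ℝ <ℝ φ* τ
    ; start = root
    ; p     = λ τ σ s → onEdge τ σ (divide (φ* σ) (φ* τ) s)
    }

  0ᶠ : Fin d
  0ᶠ = Fin.fromℕ< (ℕ.≤-trans (s≤s z≤n) 2≤d)

  extend : ∀ τ → ∃ λ σ → τ ↗ σ
  extend τ = go (nodes τ) refl
    where
    go : ∀ ns → nodes τ ≡ ns → ∃ λ σ → τ ↗ σ
    go [] e with () ← subst ([] ∈_) e (root∈ τ)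
    go (v ∷ ns) e = cons τ (v ∷ʳ 0ᶠ) fits , v ∷ʳ 0ᶠ
                  , (λ q → ≺-irrefl (All.lookup (proj₂ fits) q)) , mk⇔ id id
      where
      v≺ : ∀ w → w ≺ w ∷ʳ 0ᶠ
      v≺ []      = halt
      v≺ (x ∷ w) = next refl (v≺ w)
      fits : Fits τ (v ∷ʳ 0ᶠ)
      fits = lose (subst (v ∈_) (sym e) (here refl)) (lose (∈-allFin 0ᶠ) refl)
           , subst (All (_≺ v ∷ʳ 0ᶠ)) (sym e)
               (v≺ v ∷ All.map (λ q → ≺-trans q (v≺ v))
                 (AllPairs.head (subst (AllPairs (flip _≺_)) e (sorted τ))))

  _∷ʳᵖ_ : ∀ {τ σ σ′} → Path τ σ → .(σ ↗ σ′) → Path τ σ′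
  []      ∷ʳᵖ f = f ∷ []
  (e ∷ q) ∷ʳᵖ f = e ∷ (q ∷ʳᵖ f)

  reach : ∀ n → ∃ λ σ → size σ ≡ suc n × Path root σ
  reach zero    = root , refl , []
  reach (suc n) with reach n
  ... | σ , eq , q with extend σ
  ... | σ′ , e = σ′ , trans (↗-size {σ} {σ′} e) (cong suc eq) , q ∷ʳᵖ e

  #pathsTo-nonZero : ∀ n → ℕ.NonZero (#pathsTo root n)
  #pathsTo-nonZero n with reach n
  ... | σ , eq , q = ℕ.>-nonZero (positive (level n) (level-complete n {σ} eq))
    where
    nonempty : ∀ {A : Set} {x : A} {xs} → x ∈ xs → 1 ≤ length xs
    nonempty (here _)  = s≤s z≤n
    nonempty (there _) = s≤s z≤n
    positive : ∀ σs → σ ∈ σs → 1 ≤ sum (map (#paths root) σs)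
    positive (_ ∷ σs) (here refl) = ℕ.≤-trans (nonempty (paths-complete q)) (ℕ.m≤m+n _ _)
    positive (τ ∷ σs) (there r)   = ℕ.≤-trans (positive σs r) (ℕ.m≤n+m _ (#paths root τ))

  φ : ℕ → Tree → ℚ
  φ n τ = ((+ #pathsTo τ n) ℚ./ #pathsTo root n) {{#pathsTo-nonZero n}}

  IsSubsequentialLimit : (Tree → ℝ) → Set
  IsSubsequentialLimit φ* = ∃ λ (n : ℕ → ℕ) →
    (∀ k → n k ℕ.< n (suc k)) × (∀ τ → (λ k → φ (n k) τ) ⟶ φ* τ)

  IsMERW : Chain → Set
  IsMERW C = ∃ λ φ* → IsSubsequentialLimit φ* × C ≈ ratioChain φ*

{-# OPTIONS --safe #-}
module Submission where

-- A tree with m nodes has c(m) = 1 + (d-1)m successors, whatever its shape: the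
-- dm children of its nodes are the m-1 nodes other than the root together with
-- the addable words. Hence the number of paths from τ to level n is the product
-- c(|τ|) c(|τ|+1) ⋯ c(n), and φₙ(τ) = 1 / (c(1) ⋯ c(|τ|-1)) as soon as |τ| ≤ n+1.
-- The sequence φₙ(τ) is eventually constant, so every subsequential limit is this
-- function, and its ratio along an edge out of τ is 1 / c(|τ|).

open import Data.Bool.Base using (true; false; if_then_else_)
import Data.Fin.Properties as Fin
open import Data.Integer.Base as ℤ using () renaming (+_ to pos)
import Data.Integer.Properties as ℤ
import Data.Integer.Solver as ℤ
open import Data.List.Base hiding (find; any; all; lookup; sum)
import Data.List.Membership.DecPropositional as DecMembership
open import Data.List.Membership.Propositional using (_∈_)
open import Data.List.Membership.Propositional.Properties
open import Data.List.Membership.Propositional.Properties.WithK using (unique∧set⇒bag)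
import Data.List.Properties as List
open import Data.List.Relation.Binary.BagAndSetEquality using (_∼[_]_; set; ∼bag⇒↭)
import Data.List.Relation.Binary.Lex.Strict as Lex
open import Data.List.Relation.Binary.Permutation.Propositional.Properties using (↭-length)
open import Data.List.Relation.Binary.Pointwise using (Pointwise-≡⇒≡)
open import Data.List.Relation.Unary.All as All using (All; []; _∷_)
import Data.List.Relation.Unary.All.Properties as All
open import Data.List.Relation.Unary.AllPairs using (AllPairs; []; _∷_)
import Data.List.Relation.Unary.AllPairs.Properties as AllPairs
open import Data.List.Relation.Unary.Any using (here; there)
open import Data.List.Relation.Unary.Unique.Propositional using (Unique)
import Data.List.Relation.Unary.Unique.Propositional.Properties as Unique
open import Data.Nat.Base as ℕ using (ℕ; zero; suc; _≤_; _+_; _*_; _∸_; z≤n; s≤s)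
open import Data.Nat.ListAction using (sum)
import Data.Nat.Properties as ℕ
open import Data.Nat.Solver using (module +-*-Solver)
open import Data.Product.Base using (∃; ∃₂; _×_; _,_; proj₁; proj₂)
open import Data.Rational.Base as ℚ using (ℚ; 0ℚ; 1ℚ; ½)
import Data.Rational.Properties as ℚ
import Data.Rational.Solver as ℚ
open import Data.Rational.Unnormalised.Base as ℚᵘ using (mkℚᵘ; *≡*)
import Data.Rational.Unnormalised.Properties as ℚᵘ
open import Data.Sum.Base using (_⊎_; inj₁; inj₂; [_,_]′)
open import Function.Base using (_∘_; flip)
open import Function.Bundles using (mk⇔; Equivalence)
open import Relation.Binary.Definitions using (tri<; tri≈; tri>)
open import Relation.Binary.PropositionalEquality
open import Relation.Nullary using (¬_; Dec; yes; no; does; contradiction)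
open import Relation.Nullary.Decidable using (¬?)

open import Defs
open ℝ
open ℚ-Lemmas

-- Counting and summing over finite lists.

private variable
  X Y : Set

∈-skip : ∀ {x y : X} as {bs} → y ∈ as ++ x ∷ bs → y ≢ x → y ∈ as ++ bs
∈-skip as p y≢x with ∈-++⁻ as p
... | inj₁ q           = ∈-++⁺ˡ q
... | inj₂ (here y≡x)  = contradiction y≡x y≢x
... | inj₂ (there q)   = ∈-++⁺ʳ as q

-- Pigeonhole principle, for a relation instead of a function so that images may depend on
-- membership proofs. Deleting the image `y` of the head from `ys` keeps the images of the tail,
-- since `inj` and the absence of repetitions keep them away from `y`.
injective⇒length-≤ : (R : X → Y → Set) {xs : List X} {ys : List Y} → Unique xs →
  (∀ {x} → x ∈ xs → ∃ λ y → y ∈ ys × R x y) →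
  (∀ {x x′ y} → R x y → R x′ y → x ≡ x′) →
  length xs ≤ length ys
injective⇒length-≤ R [] _ _ = z≤n
injective⇒length-≤ R {x ∷ xs} (x∉ ∷ u) image inj with image (here refl)
... | y , y∈ , Rxy with ∈-∃++ y∈
... | as , bs , refl = ℕ.≤-trans (s≤s (injective⇒length-≤ R u image′ inj))
                         (ℕ.≤-reflexive (sym (List.length-++-sucʳ as y bs)))
  where
  image′ : ∀ {x′} → x′ ∈ xs → ∃ λ y′ → y′ ∈ as ++ bs × R x′ y′
  image′ p with image (there p)
  ... | y′ , y′∈ , Rx′y′ =
    y′ , ∈-skip as y′∈ (λ { refl → All.lookup x∉ p (inj Rxy Rx′y′) }) , Rx′y′

length-concatMap : (f : X → List Y) (xs : List X) →
  length (concatMap f xs) ≡ sum (map (length ∘ f) xs)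
length-concatMap f []       = refl
length-concatMap f (x ∷ xs) =
  trans (List.length-++ (f x)) (cong (length (f x) +_) (length-concatMap f xs))

sum-map-0 : (xs : List X) → sum (map (λ _ → 0) xs) ≡ 0
sum-map-0 []       = refl
sum-map-0 (_ ∷ xs) = sum-map-0 xs

sum-map-+ : (f g : X → ℕ) (xs : List X) →
  sum (map (λ x → f x + g x) xs) ≡ sum (map f xs) + sum (map g xs)
sum-map-+ f g []       = refl
sum-map-+ f g (x ∷ xs) = trans (cong (f x + g x +_) (sum-map-+ f g xs))
  (solve 4 (λ a b s t → a :+ b :+ (s :+ t) := a :+ s :+ (b :+ t)) refl
     (f x) (g x) (sum (map f xs)) (sum (map g xs)))
  where open +-*-Solver

sum-swap : (f : X → Y → ℕ) (xs : List X) (ys : List Y) →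
  sum (map (λ x → sum (map (f x) ys)) xs) ≡ sum (map (λ y → sum (map (λ x → f x y) xs)) ys)
sum-swap f []       ys = sym (sum-map-0 ys)
sum-swap f (x ∷ xs) ys = trans (cong (sum (map (f x) ys) +_) (sum-swap f xs ys))
  (sym (sum-map-+ (f x) (λ y → sum (map (λ x → f x y) xs)) ys))

sum-filter : {P : X → Set} (P? : ∀ x → Dec (P x)) (f : X → ℕ) {c : ℕ} (xs : List X) →
  (∀ {x} → P x → f x ≡ c) → (∀ {x} → ¬ P x → f x ≡ 0) →
  sum (map f xs) ≡ length (filter P? xs) * c
sum-filter P? f []       _  _   = refl
sum-filter P? f (x ∷ xs) on off with P? x
... | yes Px = cong₂ _+_ (on Px) (sum-filter P? f xs on off)
... | no ¬Px = cong₂ _+_ (off ¬Px) (sum-filter P? f xs on off)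

-- Fractions of natural numbers.

/-≡ : ∀ a b c d .{{_ : ℕ.NonZero b}} .{{_ : ℕ.NonZero d}} → a * d ≡ c * b → pos a ℚ./ b ≡ pos c ℚ./ d
/-≡ a (suc b) c (suc d) eq = ℚ.fromℚᵘ-cong {mkℚᵘ (pos a) b} {mkℚᵘ (pos c) d}
  (*≡* (trans (sym (ℤ.pos-* a (suc d))) (trans (cong pos eq) (ℤ.pos-* c (suc b)))))

/-+ : ∀ a b c .{{_ : ℕ.NonZero c}} → pos a ℚ./ c ℚ.+ pos b ℚ./ c ≡ pos (a + b) ℚ./ c
/-+ a b (suc c) = ℚ.toℚᵘ-injective (begin-equality
  ℚ.toℚᵘ (pos a ℚ./ suc c ℚ.+ pos b ℚ./ suc c)                ≃⟨ ℚ.toℚᵘ-homo-+ (pos a ℚ./ suc c) (pos b ℚ./ suc c) ⟩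
  ℚ.toℚᵘ (pos a ℚ./ suc c) ℚᵘ.+ ℚ.toℚᵘ (pos b ℚ./ suc c)
    ≃⟨ ℚᵘ.+-cong (ℚ.toℚᵘ-fromℚᵘ (mkℚᵘ (pos a) c)) (ℚ.toℚᵘ-fromℚᵘ (mkℚᵘ (pos b) c)) ⟩
  mkℚᵘ (pos a) c ℚᵘ.+ mkℚᵘ (pos b) c                          ≃⟨ *≡* eq ⟩
  mkℚᵘ (pos (a + b)) c                                      ≃⟨ ℚ.toℚᵘ-fromℚᵘ (mkℚᵘ (pos (a + b)) c) ⟨
  ℚ.toℚᵘ (pos (a + b) ℚ./ suc c)                            ∎)
  where
  open ℚᵘ.≤-Reasoning
  open ℤ.+-*-Solver
  eq : (pos a ℤ.* pos (suc c) ℤ.+ pos b ℤ.* pos (suc c)) ℤ.* pos (suc c) ≡ pos (a + b) ℤ.* pos (suc c * suc c)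
  eq = trans (solve 3 (λ a b c → (a :* c :+ b :* c) :* c := (a :+ b) :* (c :* c)) refl (pos a) (pos b) (pos (suc c)))
         (cong₂ ℤ._*_ (sym (ℤ.pos-+ a b)) (sym (ℤ.pos-* (suc c) (suc c))))

1/-* : ∀ m n .{{_ : ℕ.NonZero m}} .{{_ : ℕ.NonZero n}} .{{_ : ℕ.NonZero (m * n)}} →
  pos 1 ℚ./ (m * n) ≡ (pos 1 ℚ./ m) ℚ.* (pos 1 ℚ./ n)
1/-* (suc m) (suc n) = ℚ.toℚᵘ-injective (begin-equality
  ℚ.toℚᵘ (pos 1 ℚ./ (suc m * suc n))                        ≃⟨ ℚ.toℚᵘ-fromℚᵘ (mkℚᵘ (pos 1) _) ⟩
  mkℚᵘ (pos 1) m ℚᵘ.* mkℚᵘ (pos 1) n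
    ≃⟨ ℚᵘ.*-cong (ℚ.toℚᵘ-fromℚᵘ (mkℚᵘ (pos 1) m)) (ℚ.toℚᵘ-fromℚᵘ (mkℚᵘ (pos 1) n)) ⟨
  ℚ.toℚᵘ (pos 1 ℚ./ suc m) ℚᵘ.* ℚ.toℚᵘ (pos 1 ℚ./ suc n)      ≃⟨ ℚ.toℚᵘ-homo-* (pos 1 ℚ./ suc m) (pos 1 ℚ./ suc n) ⟨
  ℚ.toℚᵘ ((pos 1 ℚ./ suc m) ℚ.* (pos 1 ℚ./ suc n))            ∎)
  where open ℚᵘ.≤-Reasoning

1/-pos : ∀ n .{{_ : ℕ.NonZero n}} → 0ℚ ℚ.< pos 1 ℚ./ n
1/-pos n = ℚ.positive⁻¹ (pos 1 ℚ./ n) {{ℚ.normalize-pos 1 n}}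

∣p-p∣<ε : ∀ p {ε} → 0ℚ ℚ.< ε → ℚ.∣ p ℚ.- p ∣ ℚ.< ε
∣p-p∣<ε p {ε} 0<ε = subst (λ t → ℚ.∣ t ∣ ℚ.< ε) (sym (ℚ.+-inverseʳ p)) 0<ε

-- Equality and order of Cauchy reals.

≃-refl : ∀ {x} → x ≃ x
≃-refl {x} ε 0<ε = 0 , λ n _ → ∣p-p∣<ε (seq x n) 0<ε

≃-sym : ∀ {x y} → x ≃ y → y ≃ x
≃-sym {x} {y} e ε 0<ε with e ε 0<ε
... | N , h = N , λ n N≤n → subst (ℚ._< ε) (∣∣-sym (seq x n) (seq y n)) (h n N≤n)

≃-trans : ∀ {x y z} → x ≃ y → y ≃ z → x ≃ z
≃-trans {x} {y} {z} e f ε 0<ε with e (ε ℚ.* ½) (half-pos 0<ε) | f (ε ℚ.* ½) (half-pos 0<ε)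
... | N , h | M , k = N ℕ.⊔ M , λ n N⊔M≤n →
  subst (λ t → ℚ.∣ t ∣ ℚ.< ε) (lem (seq x n) (seq y n) (seq z n))
    (ℚ.≤-<-trans (ℚ.∣p+q∣≤∣p∣+∣q∣ (seq x n ℚ.- seq y n) (seq y n ℚ.- seq z n))
      (<-substʳ (half+half ε)
        (ℚ.+-mono-< (h n (ℕ.m⊔n≤o⇒m≤o N M N⊔M≤n)) (k n (ℕ.m⊔n≤o⇒n≤o N M N⊔M≤n)))))
  where
  open ℚ.+-*-Solver
  lem : ∀ a b c → (a ℚ.- b) ℚ.+ (b ℚ.- c) ≡ a ℚ.- c
  lem = solve 3 (λ a b c → (a :- b) :+ (b :- c) := a :- c) refl

if-cong : ∀ {P : Set} x y (P? : Dec P) → (P → x ≃ y) →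
  (if does P? then x else 0ℝ) ≃ (if does P? then y else 0ℝ)
if-cong x y (yes p) x≃y = x≃y p
if-cong x y (no _)  _   = ≃-refl {0ℝ}

fromℚ-nonneg : ∀ {q} → 0ℚ ℚ.≤ q → 0ℝ ≤ℝ fromℚ q
fromℚ-nonneg {q} 0≤q (δ , 0<δ , N , h) = ℚ.<-irrefl refl (ℚ.<-≤-trans 0<δ
  (ℚ.≤-trans (subst (ℚ._≤ q ℚ.+ δ) (ℚ.+-identityˡ δ) (ℚ.+-monoˡ-≤ δ 0≤q)) (h N ℕ.≤-refl)))

if-nonneg : ∀ {P : Set} {x} (P? : Dec P) → 0ℝ ≤ℝ x → 0ℝ ≤ℝ (if does P? then x else 0ℝ)
if-nonneg (yes _) 0≤x = 0≤x
if-nonneg (no _)  _   = fromℚ-nonneg ℚ.≤-refl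

if-no : ∀ {P : Set} x (P? : Dec P) → ¬ P → (if does P? then x else 0ℝ) ≃ 0ℝ
if-no x (yes p) ¬p = contradiction p ¬p
if-no x (no _)  _  = ≃-refl {0ℝ}

-- Limits of eventually constant sequences.

Eventually : (ℕ → ℚ) → ℚ → Set
Eventually q a = ∃ λ K → ∀ k → K ≤ k → q k ≡ a

eventually⇒⟶ : ∀ {q a} → Eventually q a → q ⟶ fromℚ a
-- Beyond `K` the distance is exactly 0, so the gap demanded by `<ℝ` can be `ε` itself.
eventually⇒⟶ {q} {a} (K , h) ε 0<ε = K , λ k K≤k → ε , 0<ε , 0 , λ _ _ →
  ℚ.≤-reflexive (trans (cong (λ t → ℚ.∣ t ℚ.- a ∣ ℚ.+ ε) (h k K≤k))
    (trans (cong (λ t → ℚ.∣ t ∣ ℚ.+ ε) (ℚ.+-inverseʳ a)) (ℚ.+-identityˡ ε)))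

-- One index suffices: at `K ⊔ L` the sequence already equals `a` and lies within `ε` of `x`, which
-- bounds the distance from `a` to `x`.
⟶-unique : ∀ {q a x} → Eventually q a → q ⟶ x → x ≃ fromℚ a
⟶-unique {q} {a} {x} (K , h) lim ε 0<ε with lim ε 0<ε
... | L , close with close (K ℕ.⊔ L) (ℕ.m≤n⊔m K L)
... | δ , 0<δ , N , below = N , λ n N≤n → subst (ℚ._< ε)
    (trans (cong (λ t → ℚ.∣ t ℚ.- seq x n ∣) (h (K ℕ.⊔ L) (ℕ.m≤m⊔n K L))) (∣∣-sym a (seq x n)))
    (ℚ.<-≤-trans (subst (ℚ._< gap n ℚ.+ δ) (ℚ.+-identityʳ (gap n)) (ℚ.+-monoʳ-< (gap n) 0<δ)) (below n N≤n))
  where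
  gap : ℕ → ℚ
  gap n = ℚ.∣ q (K ℕ.⊔ L) ℚ.- seq x n ∣

≃-positive : ∀ {a x} → x ≃ fromℚ a → 0ℚ ℚ.< a → 0ℝ <ℝ x
≃-positive {a} {x} e 0<a with e (a ℚ.* ½) (half-pos 0<a)
-- Half of `a` is spent on the distance to `x`; the other half is the positive lower bound.
... | N , h = a ℚ.* ½ , half-pos 0<a , N , λ n N≤n → lower (seq x n) (h n N≤n)
  where
  open ℚ.+-*-Solver
  lower : ∀ s → ℚ.∣ s ℚ.- a ∣ ℚ.< a ℚ.* ½ → 0ℚ ℚ.+ a ℚ.* ½ ℚ.≤ s
  -- s ≥ a - |a - s| ≥ a - a/2 = a/2.
  lower s close = ≤-substˡ
    (trans (ℚ.+-identityˡ (a ℚ.* ½)) (trans (solve 1 (λ h → h := h :+ h :- h) refl (a ℚ.* ½)) (cong (ℚ._- a ℚ.* ½) (half+half a))))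
    (≤-substʳ (solve 3 (λ a s h → s :+ h :- h := s) refl a s (a ℚ.* ½))
      (ℚ.+-monoˡ-≤ (ℚ.- (a ℚ.* ½))
        (≤-substˡ (solve 2 (λ a s → a := s :+ (a :- s)) refl a s)
          (ℚ.+-monoʳ-≤ s (ℚ.≤-trans (p≤∣p∣ (a ℚ.- s))
            (ℚ.<⇒≤ (subst (ℚ._< a ℚ.* ½) (∣∣-sym s a) close)))))))
    where
    p≤∣p∣ : ∀ p → p ℚ.≤ ℚ.∣ p ∣
    p≤∣p∣ p with ℚ.≤-total 0ℚ p
    ... | inj₁ 0≤p = ℚ.≤-reflexive (sym (ℚ.0≤p⇒∣p∣≡p 0≤p))
    ... | inj₂ p≤0 = ℚ.≤-trans p≤0 (ℚ.0≤∣p∣ p)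

-- Quotients of reals.

-- With w = 1/v, uw - q = w ((u - qb) + q (b - v)).
quotient-close : ∀ {u v w q b B η ζ} → 0ℚ ℚ.< B → 0ℚ ℚ.< q → w ℚ.* v ≡ 1ℚ → ℚ.∣ w ∣ ℚ.≤ B →
  ℚ.∣ u ℚ.- q ℚ.* b ∣ ℚ.< η ℚ.* ½ → ℚ.∣ v ℚ.- b ∣ ℚ.< ζ → q ℚ.* ζ ≡ η ℚ.* ½ →
  ℚ.∣ u ℚ.* w ℚ.- q ∣ ℚ.< B ℚ.* η
quotient-close {u} {v} {w} {q} {b} {B} {η} {ζ} 0<B 0<q wv≡1 w≤B u≈ v≈ qζ≡ =
  subst (ℚ._< B ℚ.* η) (sym error-product) (bound-* B w (u ℚ.- q ℚ.* v) η 0<B w≤B difference)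
  where
  open ℚ.+-*-Solver
  factor : u ℚ.* w ℚ.- q ℚ.* (w ℚ.* v) ≡ w ℚ.* (u ℚ.- q ℚ.* v)
  factor = solve 4 (λ u v w q → u :* w :- q :* (w :* v) := w :* (u :- q :* v)) refl u v w q
  error-product : ℚ.∣ u ℚ.* w ℚ.- q ∣ ≡ ℚ.∣ w ∣ ℚ.* ℚ.∣ u ℚ.- q ℚ.* v ∣
  error-product = trans (cong ℚ.∣_∣ (trans
      (cong (λ t → u ℚ.* w ℚ.- t) (trans (sym (ℚ.*-identityʳ q)) (cong (q ℚ.*_) (sym wv≡1)))) factor))
    (ℚ.∣p*q∣≡∣p∣*∣q∣ w (u ℚ.- q ℚ.* v))
  scaled-v≈ : ℚ.∣ q ℚ.* (b ℚ.- v) ∣ ℚ.< η ℚ.* ½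
  scaled-v≈ = subst₂ ℚ._<_ (sym (ℚ.∣p*q∣≡∣p∣*∣q∣ q (b ℚ.- v))) qζ≡
    (bound-* q q (b ℚ.- v) ζ 0<q (ℚ.≤-reflexive (ℚ.0≤p⇒∣p∣≡p (ℚ.<⇒≤ 0<q)))
      (subst (ℚ._< ζ) (∣∣-sym v b) v≈))
  regroup : (u ℚ.- q ℚ.* b) ℚ.+ q ℚ.* (b ℚ.- v) ≡ u ℚ.- q ℚ.* v
  regroup = solve 4 (λ u v q b → (u :- q :* b) :+ q :* (b :- v) := u :- q :* v) refl u v q b
  difference : ℚ.∣ u ℚ.- q ℚ.* v ∣ ℚ.< η
  difference = subst₂ (λ s t → ℚ.∣ s ∣ ℚ.< t) regroup (half+half η)
    (ℚ.≤-<-trans (ℚ.∣p+q∣≤∣p∣+∣q∣ (u ℚ.- q ℚ.* b) (q ℚ.* (b ℚ.- v))) (ℚ.+-mono-< u≈ scaled-v≈))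

-- `z` stands for `inv y`, whose terms are the reciprocals of those of `y` from the index `N` on.
-- The shift does no harm, because `y` is eventually close to `b` at the shifted indices too.
*-reciprocal : ∀ {q b} (x y z : ℝ) N → 0ℚ ℚ.< q → (∀ n → seq z n ℚ.* seq y (N + n) ≡ 1ℚ) →
  x ≃ fromℚ (q ℚ.* b) → y ≃ fromℚ b → x *ℝ z ≃ fromℚ q
*-reciprocal {q} {b} x y z N 0<q zy≡1 x≃ y≃ ε 0<ε = N₁ ℕ.⊔ (N₂ ℕ.⊔ N₃) , close
  where
  bz = bounded (cauchy z)
  B = proj₁ bz
  0<B = proj₁ (proj₂ bz)
  N₁ = proj₁ (proj₂ (proj₂ bz))
  -- The tolerances are η = ε/B and ζ = η/(2q): an error η in x - q y is multiplied by at most `B`,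
  -- and half of it is left to each of x and q y.
  sη = scaled B ε 0<B 0<ε
  η = proj₁ sη
  0<η½ = half-pos (proj₁ (proj₂ sη))
  sζ = scaled q (η ℚ.* ½) 0<q 0<η½
  ζ = proj₁ sζ
  hx = x≃ (η ℚ.* ½) 0<η½
  hy = y≃ ζ (proj₁ (proj₂ sζ))
  N₂ = proj₁ hx
  N₃ = proj₁ hy
  close : ∀ n → N₁ ℕ.⊔ (N₂ ℕ.⊔ N₃) ≤ n → ℚ.∣ seq x n ℚ.* seq z n ℚ.- q ∣ ℚ.< ε
  close n a = <-substʳ (proj₂ (proj₂ sη))
    (quotient-close {seq x n} {seq y (N + n)} {seq z n} {q} {b} {B} {η} {ζ} 0<B 0<q (zy≡1 n)
      (proj₂ (proj₂ (proj₂ bz)) n (ℕ.m⊔n≤o⇒m≤o N₁ (N₂ ℕ.⊔ N₃) a))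
      (proj₂ hx n (ℕ.m⊔n≤o⇒m≤o N₂ N₃ a′))
      (proj₂ hy (N + n) (ℕ.≤-trans (ℕ.m⊔n≤o⇒n≤o N₂ N₃ a′) (ℕ.m≤n+m n N)))
      (proj₂ (proj₂ sζ)))
    where
    a′ : N₂ ℕ.⊔ N₃ ≤ n
    a′ = ℕ.m⊔n≤o⇒n≤o N₁ (N₂ ℕ.⊔ N₃) a

divide-≃ : ∀ {q b} x y (0<y : 0ℝ <ℝ y) → 0ℚ ℚ.< q → x ≃ fromℚ (q ℚ.* b) → y ≃ fromℚ b →
  divide x y 0<y ≃ fromℚ q
divide-≃ x y 0<y@(δ , 0<δ , N , away) 0<q =
  *-reciprocal x y (inv y 0<y) N 0<q
    (λ n → ℚ.*-inverseˡ (seq y (N + n)) {{above⇒nonZero 0<δ (away (N + n) (ℕ.m≤m+n N n))}})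

-- Every summand is a constant sequence, so the sum is an exact fraction at each index and no limit
-- has to be taken.
seq-sum-indicator : {P : X → Set} (P? : ∀ x → Dec (P x)) (xs : List X) (b : ℕ) .{{_ : ℕ.NonZero b}} (n : ℕ) →
  seq (sumℝ (map (λ x → if does (P? x) then fromℚ (pos 1 ℚ./ b) else 0ℝ) xs)) n
    ≡ pos (length (filter P? xs)) ℚ./ b
seq-sum-indicator P? []       b n = /-≡ 0 1 0 b refl
seq-sum-indicator P? (x ∷ xs) b n with does (P? x)
... | true  = trans (cong (pos 1 ℚ./ b ℚ.+_) (seq-sum-indicator P? xs b n))
                (/-+ 1 (length (filter P? xs)) b)
... | false = trans (ℚ.+-identityˡ _) (seq-sum-indicator P? xs b n)

module TreeGrowth (d : ℕ) (2≤d : 2 ≤ d) where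
  open DAryTrees d 2≤d
  open DecMembership _≟ʷ_ using (_∈?_)

  -- Counting the words that can be added to a tree.

  branching : ℕ → ℕ
  branching m = 1 + (d ∸ 1) * m

  children : Tree → List Word
  children τ = cartesianProductWith _∷ʳ_ (nodes τ) (allFin d)

  length-children : ∀ τ → length (children τ) ≡ size τ * d
  length-children τ = go (nodes τ)
    where
    go : ∀ us → length (cartesianProductWith _∷ʳ_ us (allFin d)) ≡ length us * d
    go []       = refl
    go (u ∷ us) = trans (List.length-++ (map (u ∷ʳ_) (allFin d)))
      (cong₂ _+_ (trans (List.length-map (u ∷ʳ_) (allFin d)) (List.length-tabulate (λ i → i))) (go us))

  children-unique : ∀ τ → Unique (children τ)
  children-unique τ = Unique.cartesianProductWith⁺ _∷ʳ_
    (λ {w} {x} → List.∷ʳ-injective w x) (unique-nodes τ) (Unique.allFin⁺ d)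

  child : ∀ {τ u} i → u ∈ nodes τ → u ∷ʳ i ∈ children τ
  child i u∈ = ∈-cartesianProductWith⁺ _∷ʳ_ u∈ (∈-allFin i)

  parent : ∀ {τ v} → v ∈ children τ → ∃₂ λ u i → u ∈ nodes τ × v ≡ u ∷ʳ i
  parent {τ} v∈ with ∈-cartesianProductWith⁻ _∷ʳ_ (nodes τ) (allFin d) v∈
  ... | u , i , u∈ , _ , v≡ = u , i , u∈ , v≡

  sprouts : Tree → List Word
  sprouts τ = filter (¬? ∘ (_∈? nodes τ)) (children τ)

  sprouts-unique : ∀ τ → Unique (sprouts τ)
  sprouts-unique τ = Unique.filter⁺ _ (children-unique τ)

  -- Every node other than the root is the child of a node.
  sprouts++nodes : ∀ τ → sprouts τ ++ nodes τ ∼[ set ] [] ∷ children τ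
  sprouts++nodes τ = mk⇔ to from
    where
    nodes⊆ : ∀ {v} → v ∈ nodes τ → v ∈ [] ∷ children τ
    nodes⊆ {v} v∈ with initLast v
    ... | []       = here refl
    ... | u ∷ʳ′ i = there (child {τ} i (closed τ u (i ∷ []) v∈))
    to : ∀ {v} → v ∈ sprouts τ ++ nodes τ → v ∈ [] ∷ children τ
    to p = [ there ∘ proj₁ ∘ ∈-filter⁻ _ , nodes⊆ ]′ (∈-++⁻ (sprouts τ) p)
    from : ∀ {v} → v ∈ [] ∷ children τ → v ∈ sprouts τ ++ nodes τ
    from (here refl) = ∈-++⁺ʳ (sprouts τ) (root∈ τ)
    from {v} (there p) with v ∈? nodes τ
    ... | yes v∈ = ∈-++⁺ʳ (sprouts τ) v∈
    ... | no v∉  = ∈-++⁺ˡ (∈-filter⁺ _ p v∉)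

  -- By `sprouts++nodes`, two lists without repetitions have the same elements, hence the same
  -- length: s + m = 1 + md for s sprouts and m nodes. Cancelling m gives s.
  length-sprouts : ∀ τ → length (sprouts τ) ≡ branching (size τ)
  length-sprouts τ = ℕ.+-cancelʳ-≡ (size τ) _ _ (begin
    length (sprouts τ) + size τ        ≡⟨ List.length-++ (sprouts τ) ⟨
    length (sprouts τ ++ nodes τ)      ≡⟨ ↭-length (∼bag⇒↭ (unique∧set⇒bag
                                            (Unique.++⁺ (sprouts-unique τ) (unique-nodes τ) disjoint)
                                            ([]∉children ∷ children-unique τ)
                                            (sprouts++nodes τ))) ⟩
    1 + length (children τ)            ≡⟨ cong suc (length-children τ) ⟩
    1 + size τ * d                     ≡⟨ cong (λ e → 1 + size τ * e) (ℕ.suc-pred d) ⟨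
    1 + size τ * suc (d ∸ 1)           ≡⟨ solve 2 (λ s e → con 1 :+ s :* (con 1 :+ e)
                                                        := con 1 :+ e :* s :+ s) refl (size τ) (d ∸ 1) ⟩
    branching (size τ) + size τ        ∎)
    where
    open ≡-Reasoning
    open +-*-Solver
    instance
      d≢0 : ℕ.NonZero d
      d≢0 = ℕ.>-nonZero (ℕ.≤-trans (s≤s z≤n) 2≤d)
    disjoint : ∀ {v} → ¬ (v ∈ sprouts τ × v ∈ nodes τ)
    disjoint (p , q) = proj₂ (∈-filter⁻ (¬? ∘ (_∈? nodes τ)) {xs = children τ} p) q
    []∉children : All ([] ≢_) (children τ)
    []∉children = All.tabulate lem
      where
      lem : ∀ {v} → v ∈ children τ → [] ≢ v
      lem v∈ refl with parent {τ} v∈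
      ... | [] , _ , _ , ()
      ... | _ ∷ _ , _ , _ , ()

  -- Adjoining a word to a tree.

  -- A sprout may be smaller than some nodes, where `cons` does not apply, so it is placed between
  -- the larger nodes and the smaller ones. Both filters are strict: a copy of `v` in `ns` is
  -- dropped, so the order stays strict.
  insert : List Word → Word → List Word
  insert ns v = filter (v ≺?_) ns ++ v ∷ filter (_≺? v) ns

  ∈-insert⁻ : ∀ {ns v w} → w ∈ insert ns v → w ≡ v ⊎ w ∈ ns
  ∈-insert⁻ {ns} {v} p with ∈-++⁻ (filter (v ≺?_) ns) p
  ... | inj₁ q         = inj₂ (proj₁ (∈-filter⁻ (v ≺?_) q))
  ... | inj₂ (here e)  = inj₁ e
  ... | inj₂ (there q) = inj₂ (proj₁ (∈-filter⁻ (_≺? v) q))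

  ∈-insert-self : ∀ ns {v} → v ∈ insert ns v
  ∈-insert-self ns {v} = ∈-insert (filter (v ≺?_) ns)

  ∈-insert⁺ : ∀ {ns v w} → w ∈ ns → w ∈ insert ns v
  ∈-insert⁺ {ns} {v} {w} p with Lex.<-compare sym Fin.<-cmp w v
  ... | tri< w≺v _ _ = ∈-++⁺ʳ (filter (v ≺?_) ns) (there (∈-filter⁺ (_≺? v) p w≺v))
  ... | tri> _ _ v≺w = ∈-++⁺ˡ (∈-filter⁺ (v ≺?_) p v≺w)
  ... | tri≈ _ w≋v _ = subst (_∈ insert ns v) (sym (Pointwise-≡⇒≡ w≋v)) (∈-insert-self ns)

  insert-sorted : ∀ {ns v} → AllPairs (flip _≺_) ns → AllPairs (flip _≺_) (insert ns v)
  insert-sorted {ns} {v} s = AllPairs.++⁺ (AllPairs.filter⁺ (v ≺?_) s)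
    (All.all-filter (_≺? v) ns ∷ AllPairs.filter⁺ (_≺? v) s)
    (All.map (λ v≺w → v≺w ∷ All.map (λ u≺v → ≺-trans u≺v v≺w) (All.all-filter (_≺? v) ns))
      (All.all-filter (v ≺?_) ns))

  adjoin : ∀ τ {u} i → u ∈ nodes τ → Tree
  adjoin τ {u} i u∈ = tree (insert (nodes τ) (u ∷ʳ i)) (insert-sorted (sorted τ)) (∈-insert⁺ (root∈ τ)) cl
    where
    cl : ∀ x y → x ++ y ∈ insert (nodes τ) (u ∷ʳ i) → x ∈ insert (nodes τ) (u ∷ʳ i)
    cl x y p with ∈-insert⁻ {nodes τ} p
    ... | inj₂ q = ∈-insert⁺ (closed τ x y q)
    -- A prefix of a child of `u` is that child itself or a prefix of `u`.
    ... | inj₁ e with prefix-snoc x y u i e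
    ... | inj₁ refl      = ∈-insert-self (nodes τ)
    ... | inj₂ (z , e′) = ∈-insert⁺ (closed τ x z (subst (_∈ nodes τ) (sym e′) u∈))

  sprout⇒addable : ∀ τ {v} → v ∈ sprouts τ → Addable τ v
  sprout⇒addable τ v∈ with ∈-filter⁻ (¬? ∘ (_∈? nodes τ)) {xs = children τ} v∈
  ... | c , v∉ with parent {τ} c
  ... | u , i , u∈ , refl = adjoin τ i u∈ , v∉ , mk⇔ to from
    where
    to : ∀ {w} → w ∈ insert (nodes τ) (u ∷ʳ i) → w ∈ u ∷ʳ i ∷ nodes τ
    to = [ here , there ]′ ∘ ∈-insert⁻ {nodes τ}
    from : ∀ {w} → w ∈ u ∷ʳ i ∷ nodes τ → w ∈ insert (nodes τ) (u ∷ʳ i)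
    from (here refl) = ∈-insert-self (nodes τ)
    from (there q)   = ∈-insert⁺ q

  -- An addable word is not the root, so it has a parent. Closure puts the parent in `σ`, and being
  -- different from the added word it was already in `τ`.
  addable⇒sprout : ∀ τ {v} → Addable τ v → v ∈ sprouts τ
  addable⇒sprout τ {v} (σ , v∉ , e) with initLast v
  ... | []       = contradiction (root∈ τ) v∉
  ... | u ∷ʳ′ i with Equivalence.to e (closed σ u (i ∷ []) (Equivalence.from e (here refl)))
  ... | there u∈ = ∈-filter⁺ _ (child {τ} i u∈) v∉
  ... | here u≡ with () ← List.++-identityʳ-unique u u≡

  addable-count : ∀ τ → NumberOf (Addable τ) (branching (size τ))
  addable-count τ = sprouts τ , sprouts-unique τ
                  , (λ v → mk⇔ (sprout⇒addable τ) (addable⇒sprout τ)) , length-sprouts τ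

  -- Successors of a tree.

  successors : Tree → List Tree
  successors τ = filter (τ ↗?_) (level (size τ))

  -- `Adjoins` is one-to-one between successors and sprouts: equal node sets give equal trees, and
  -- the only node of `σ` outside `τ` is the added word. Pigeonhole in both directions transfers the
  -- count.
  length-successors : ∀ τ → length (successors τ) ≡ branching (size τ)
  length-successors τ = trans (ℕ.≤-antisym
      (injective⇒length-≤ (λ σ v → Adjoins τ v σ) (Unique.filter⁺ _ (level-unique (size τ))) toSprout sameTree)
      (injective⇒length-≤ (Adjoins τ) (sprouts-unique τ) toSuccessor
        (λ {v} {v′} {σ} → sameNode {v} {v′} {σ})))
    (length-sprouts τ)
    where
    toSprout : ∀ {σ} → σ ∈ successors τ → ∃ λ v → v ∈ sprouts τ × Adjoins τ v σ
    toSprout {σ} p with ∈-filter⁻ (τ ↗?_) {xs = level (size τ)} p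
    ... | _ , v , a = v , addable⇒sprout τ (σ , a) , a
    toSuccessor : ∀ {v} → v ∈ sprouts τ → ∃ λ σ → σ ∈ successors τ × Adjoins τ v σ
    toSuccessor {v} p with sprout⇒addable τ p
    ... | σ , a = σ , ∈-filter⁺ (τ ↗?_) (level-complete (size τ) (↗-size {τ} {σ} (v , a))) (v , a) , a
    sameTree : ∀ {σ σ′ v} → Adjoins τ v σ → Adjoins τ v σ′ → σ ≡ σ′
    sameTree (_ , e) (_ , e′) = set-injective
      (mk⇔ (Equivalence.from e′ ∘ Equivalence.to e) (Equivalence.from e ∘ Equivalence.to e′))
    sameNode : ∀ {v v′ σ} → Adjoins τ v σ → Adjoins τ v′ σ → v ≡ v′
    sameNode (v∉ , e) (_ , e′) with Equivalence.to e′ (Equivalence.from e (here refl))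
    ... | here v≡  = v≡
    ... | there v∈ = contradiction v∈ v∉

  -- Counting paths.

  -- The product c(m) c(m+1) ⋯ c(m+k-1), a rising factorial with step d - 1. Factors are peeled off
  -- at the front, like the first edges of paths.
  rising : ℕ → ℕ → ℕ
  rising m zero    = 1
  rising m (suc k) = branching m * rising (suc m) k

  rising-nonZero : ∀ m k → ℕ.NonZero (rising m k)
  rising-nonZero m zero    = _
  rising-nonZero m (suc k) = ℕ.m*n≢0 (branching m) (rising (suc m) k) {{_}} {{rising-nonZero (suc m) k}}

  rising-+ : ∀ m j k → rising m (j + k) ≡ rising m j * rising (m + j) k
  rising-+ m zero    k = trans (cong (λ m → rising m k) (sym (ℕ.+-identityʳ m))) (sym (ℕ.+-identityʳ _))
  rising-+ m (suc j) k = begin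
    branching m * rising (suc m) (j + k)                        ≡⟨ cong (branching m *_) (rising-+ (suc m) j k) ⟩
    branching m * (rising (suc m) j * rising (suc m + j) k)     ≡⟨ ℕ.*-assoc (branching m) (rising (suc m) j) (rising (suc m + j) k) ⟨
    branching m * rising (suc m) j * rising (suc m + j) k       ≡⟨ cong (λ m′ → branching m * rising (suc m) j * rising m′ k) (ℕ.+-suc m j) ⟨
    branching m * rising (suc m) j * rising (m + suc j) k       ∎
    where open ≡-Reasoning

  -- `paths` takes its length from the sizes of both endpoints; a fixed length `k` allows induction
  -- along the first edge.
  #pathsOfLength : ℕ → Tree → ℕ → ℕ
  #pathsOfLength k τ n = sum (map (λ σ → length (pathsOfLength k τ σ)) (level n))

  -- Only the target `τ` contributes, and it occurs exactly once: at most once by uniqueness, at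
  -- least once by `τ∈`.
  sum-trivial : ∀ τ {σs} → Unique σs → τ ∈ σs → sum (map (λ σ → length (trivial (τ ≟ σ))) σs) ≡ 1
  sum-trivial τ {σs} u τ∈ = trans (sum-filter (τ ≟_) _ σs (λ {σ} → on σ) (λ {σ} → off σ))
    (trans (ℕ.*-identityʳ _) (ℕ.≤-antisym
      (injective⇒length-≤ _≡_ (Unique.filter⁺ (τ ≟_) u)
        (λ p → τ , here {xs = []} refl , sym (proj₂ (∈-filter⁻ (τ ≟_) {xs = σs} p))) (λ e e′ → trans e (sym e′)))
      (∈-length (∈-filter⁺ (τ ≟_) τ∈ refl))))
    where
    on : ∀ σ → τ ≡ σ → length (trivial (τ ≟ σ)) ≡ 1
    on σ e with τ ≟ σ
    ... | yes refl = refl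
    ... | no ne    = contradiction e ne
    off : ∀ σ → τ ≢ σ → length (trivial (τ ≟ σ)) ≡ 0
    off σ ne with τ ≟ σ
    ... | yes e = contradiction e ne
    ... | no _  = refl

  -- Each of the c(|τ|) successors has size |τ| + 1, so by induction all of them start equally many
  -- paths. The `suc n` reflects that trees at level n have n + 1 nodes.
  #pathsOfLength≡rising : ∀ k τ {n} → size τ + k ≡ suc n → #pathsOfLength k τ n ≡ rising (size τ) k
  #pathsOfLength≡rising zero    τ {n} eq =
    sum-trivial τ {level n} (level-unique n) (level-complete n {τ} (trans (sym (ℕ.+-identityʳ (size τ))) eq))
  #pathsOfLength≡rising (suc k) τ {n} eq = begin
    sum (map (λ σ → length (concatMap (λ τ′ → step τ′ σ) targets)) (level n))
      ≡⟨ cong sum (List.map-cong (λ σ → length-concatMap (λ τ′ → step τ′ σ) targets) (level n)) ⟩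
    sum (map (λ σ → sum (map (λ τ′ → length (step τ′ σ)) targets)) (level n))
      -- Exchanging the sums groups the paths by their first edge; the groups without an edge out of
      -- `τ` vanish.
      ≡⟨ sum-swap (λ σ τ′ → length (step τ′ σ)) (level n) targets ⟩
    sum (map (λ τ′ → sum (map (λ σ → length (step τ′ σ)) (level n))) targets)
      ≡⟨ sum-filter (τ ↗?_) _ targets (λ {τ′} → on τ′) (λ {τ′} → off τ′) ⟩
    length (successors τ) * rising (suc (size τ)) k
      ≡⟨ cong (_* rising (suc (size τ)) k) (length-successors τ) ⟩
    branching (size τ) * rising (suc (size τ)) k ∎
    where
    open ≡-Reasoning
    targets : List Tree
    targets = level (size τ)
    step : ∀ τ′ σ → List (Path τ σ)
    step τ′ σ = via τ τ′ (τ ↗? τ′) (pathsOfLength k τ′ σ)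
    on : ∀ τ′ → τ ↗ τ′ → sum (map (λ σ → length (step τ′ σ)) (level n)) ≡ rising (suc (size τ)) k
    on τ′ e with τ ↗? τ′
    ... | no ¬e = contradiction e ¬e
    ... | yes _ = begin
      sum (map (λ σ → length (map _ (pathsOfLength k τ′ σ))) (level n))
        ≡⟨ cong sum (List.map-cong (λ σ → List.length-map _ (pathsOfLength k τ′ σ)) (level n)) ⟩
      #pathsOfLength k τ′ n
        ≡⟨ #pathsOfLength≡rising k τ′ (trans (cong (_+ k) size≡) (trans (sym (ℕ.+-suc (size τ) k)) eq)) ⟩
      rising (size τ′) k
        ≡⟨ cong (λ m → rising m k) size≡ ⟩
      rising (suc (size τ)) k ∎
      where
      size≡ : size τ′ ≡ suc (size τ)
      size≡ = ↗-size {τ} {τ′} e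
    off : ∀ τ′ → ¬ (τ ↗ τ′) → sum (map (λ σ → length (step τ′ σ)) (level n)) ≡ 0
    off τ′ ¬e with τ ↗? τ′
    ... | yes e = contradiction e ¬e
    ... | no _  = sum-map-0 (level n)

  -- All targets in level n have the same size, so the length that `paths` computes is the same `k`
  -- for each of them.
  #pathsTo≡rising : ∀ τ {n k} → size τ + k ≡ suc n → #pathsTo τ n ≡ rising (size τ) k
  #pathsTo≡rising τ {n} {k} eq = trans
    (cong sum (List.map-cong-local {g = λ σ → length (pathsOfLength k τ σ)} (All.tabulate λ {σ} σ∈ →
      cong (λ j → length (pathsOfLength j τ σ)) (difference σ (level-sound n {σ} σ∈)))))
    (#pathsOfLength≡rising k τ eq)
    where
    difference : ∀ σ → size σ ≡ suc n → size σ ∸ size τ ≡ k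
    difference σ e = trans (cong (_∸ size τ) (trans e (sym eq))) (ℕ.m+n∸m≡n (size τ) k)

  -- The limit function.

  size-nonZero : ∀ τ → ℕ.NonZero (size τ)
  size-nonZero τ = ℕ.>-nonZero (∈-length (root∈ τ))

  -- The probability that the search tree process follows a given path from the root to `τ`: the
  -- step out of a tree of size j has probability 1/c(j), for j from 1 to |τ| - 1.
  harmonic : Tree → ℚ
  harmonic τ = (pos 1 ℚ./ rising 1 (ℕ.pred (size τ))) {{rising-nonZero 1 (ℕ.pred (size τ))}}

  harmonic-pos : ∀ τ → 0ℚ ℚ.< harmonic τ
  harmonic-pos τ = 1/-pos (rising 1 (ℕ.pred (size τ))) {{rising-nonZero 1 (ℕ.pred (size τ))}}

  harmonic-↗ : ∀ {τ σ} → τ ↗ σ → harmonic σ ≡ (pos 1 ℚ./ branching (size τ)) ℚ.* harmonic τ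
  harmonic-↗ {τ} {σ} e = trans
    (ℚ./-cong {pos 1} {_} {pos 1} {_} {{rising-nonZero 1 (ℕ.pred (size σ))}} {{nz}} refl eq)
    (1/-* (branching (size τ)) (rising 1 m) {{_}} {{rising-nonZero 1 m}} {{nz}})
    where
    open ≡-Reasoning
    m : ℕ
    m = ℕ.pred (size τ)
    nz : ℕ.NonZero (branching (size τ) * rising 1 m)
    nz = ℕ.m*n≢0 (branching (size τ)) (rising 1 m) {{_}} {{rising-nonZero 1 m}}
    size≡ : suc m ≡ size τ
    size≡ = ℕ.suc-pred (size τ) {{size-nonZero τ}}
    eq : rising 1 (ℕ.pred (size σ)) ≡ branching (size τ) * rising 1 m
    eq = begin
      rising 1 (ℕ.pred (size σ))            ≡⟨ cong (rising 1 ∘ ℕ.pred) (↗-size {τ} {σ} e) ⟩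
      rising 1 (size τ)                     ≡⟨ cong (rising 1) size≡ ⟨
      -- `rising` exposes its first factor; writing m + 1 lets `rising-+` split off the last one,
      -- c(|τ|).
      rising 1 (suc m)                      ≡⟨ cong (rising 1) (ℕ.+-comm 1 m) ⟩
      rising 1 (m + 1)                      ≡⟨ rising-+ 1 m 1 ⟩
      rising 1 m * (branching (suc m) * 1)  ≡⟨ cong (rising 1 m *_) (ℕ.*-identityʳ (branching (suc m))) ⟩
      rising 1 m * branching (suc m)        ≡⟨ ℕ.*-comm (rising 1 m) (branching (suc m)) ⟩
      branching (suc m) * rising 1 m        ≡⟨ cong (λ s → branching s * rising 1 m) size≡ ⟩
      branching (size τ) * rising 1 m       ∎

  -- The count from the root, c(1) ⋯ c(n), equals c(1) ⋯ c(|τ|-1) times the count from `τ`, so the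
  -- latter cancels. The bound on the size says that `τ` lies at level n or earlier.
  φ≡harmonic : ∀ τ {n} → size τ ≤ suc n → φ n τ ≡ harmonic τ
  φ≡harmonic τ {n} le = /-≡ (#pathsTo τ n) (#pathsTo root n) 1 (rising 1 m)
      {{#pathsTo-nonZero n}} {{rising-nonZero 1 m}} (begin
    #pathsTo τ n * rising 1 m         ≡⟨ cong (_* rising 1 m) (#pathsTo≡rising τ {n} {k} size+k) ⟩
    rising (size τ) k * rising 1 m    ≡⟨ ℕ.*-comm (rising (size τ) k) (rising 1 m) ⟩
    rising 1 m * rising (size τ) k    ≡⟨ cong (λ s → rising 1 m * rising s k) size≡ ⟨
    rising 1 m * rising (1 + m) k     ≡⟨ rising-+ 1 m k ⟨
    rising 1 (m + k)                  ≡⟨ cong (rising 1) m+k ⟩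
    rising 1 n                        ≡⟨ #pathsTo≡rising root {n} {n} refl ⟨
    #pathsTo root n                   ≡⟨ ℕ.*-identityˡ (#pathsTo root n) ⟨
    1 * #pathsTo root n               ∎)
    where
    open ≡-Reasoning
    m k : ℕ
    m = ℕ.pred (size τ)
    k = suc n ∸ size τ
    size≡ : suc m ≡ size τ
    size≡ = ℕ.suc-pred (size τ) {{size-nonZero τ}}
    size+k : size τ + k ≡ suc n
    size+k = ℕ.m+[n∸m]≡n le
    m+k : m + k ≡ n
    m+k = ℕ.suc-injective (trans (cong (_+ k) size≡) size+k)

  -- Subsequential limits and their chains.

  increasing⇒≥ : (n : ℕ → ℕ) → (∀ k → n k ℕ.< n (suc k)) → ∀ k → k ≤ n k
  increasing⇒≥ n inc zero    = z≤n
  increasing⇒≥ n inc (suc k) = ℕ.≤-<-trans (increasing⇒≥ n inc k) (inc k)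

  φ-eventually : (n : ℕ → ℕ) → (∀ k → n k ℕ.< n (suc k)) → ∀ τ → Eventually (λ k → φ (n k) τ) (harmonic τ)
  -- The threshold is |τ|: a subsequence satisfies n k ≥ k, so from there on every level n k lies
  -- beyond `τ`.
  φ-eventually n inc τ = size τ , λ k le →
    φ≡harmonic τ {n k} (ℕ.m≤n⇒m≤1+n (ℕ.≤-trans le (increasing⇒≥ n inc k)))

  limit⇒harmonic : ∀ φ* → IsSubsequentialLimit φ* → ∀ τ → φ* τ ≃ fromℚ (harmonic τ)
  limit⇒harmonic φ* (n , inc , lim) τ =
    ⟶-unique {λ k → φ (n k) τ} {harmonic τ} {φ* τ} (φ-eventually n inc τ) (lim τ)

  harmonic-limit : IsSubsequentialLimit (fromℚ ∘ harmonic)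
  -- The whole sequence converges, so the identity serves as the subsequence.
  harmonic-limit = (λ k → k) , ℕ.n<1+n , λ τ →
    eventually⇒⟶ {λ k → φ k τ} {harmonic τ} (φ-eventually (λ k → k) ℕ.n<1+n τ)

  onEdge-cong : ∀ τ σ {x y} → (τ ↗ σ → x ≃ y) → onEdge τ σ x ≃ onEdge τ σ y
  onEdge-cong τ σ {x} {y} = if-cong x y (τ ↗? σ)

  -- The limit is positive at every tree, so all trees are states, as in `searchTree`. Off the edges
  -- both chains have probability 0, and along an edge the ratio is given by `harmonic-↗`.
  ratioChain≈searchTree : ∀ φ* → IsSubsequentialLimit φ* → ratioChain φ* ≈ searchTree
  ratioChain≈searchTree φ* lim = record
    { states = λ τ → mk⇔ (λ _ → _) (λ _ → ≃-positive {harmonic τ} {φ* τ} (φ*≃ τ) (harmonic-pos τ))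
    ; starts = refl
    ; probs  = λ τ σ s _ → onEdge-cong τ σ
        {divide (φ* σ) (φ* τ) s} {fromℚ (pos 1 ℚ./ branching (size τ))} (λ e →
        divide-≃ {pos 1 ℚ./ branching (size τ)} {harmonic τ} (φ* σ) (φ* τ) s (1/-pos (branching (size τ)))
          (subst (λ q → φ* σ ≃ fromℚ q) (harmonic-↗ {τ} {σ} e) (φ*≃ σ)) (φ*≃ τ))
    }
    where
    φ*≃ : ∀ τ → φ* τ ≃ fromℚ (harmonic τ)
    φ*≃ = limit⇒harmonic φ* lim

  ≈-sym : ∀ {C D} → C ≈ D → D ≈ C
  ≈-sym {C} {D} e = record
    { states = λ τ → mk⇔ (Equivalence.from (states τ)) (Equivalence.to (states τ))
    ; starts = sym starts
    ; probs  = λ τ σ s t → ≃-sym {Chain.p C τ σ t} {Chain.p D τ σ s} (probs τ σ t s)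
    }
    where open _≈_ e

  ≈-trans : ∀ {C D E} → C ≈ D → D ≈ E → C ≈ E
  ≈-trans {C} {D} {E} e f = record
    { states = λ τ → mk⇔ (Equivalence.to (f.states τ) ∘ Equivalence.to (e.states τ))
                         (Equivalence.from (e.states τ) ∘ Equivalence.from (f.states τ))
    ; starts = trans e.starts f.starts
    ; probs  = λ τ σ s t → let r = Equivalence.to (e.states τ) s in
        ≃-trans {Chain.p C τ σ s} {Chain.p D τ σ r} {Chain.p E τ σ t} (e.probs τ σ s r) (f.probs τ σ r t)
    }
    where
    module e = _≈_ e
    module f = _≈_ f

  searchTree-isMERW : IsMERW searchTree
  searchTree-isMERW = fromℚ ∘ harmonic , harmonic-limit ,
    ≈-sym {ratioChain (fromℚ ∘ harmonic)} {searchTree} (ratioChain≈searchTree (fromℚ ∘ harmonic) harmonic-limit)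

  MERW-unique : ∀ C → IsMERW C → C ≈ searchTree
  MERW-unique C (φ* , lim , C≈) = ≈-trans {C} {ratioChain φ*} {searchTree} C≈ (ratioChain≈searchTree φ* lim)

  -- Transition laws of the search tree process.

  searchTree-isMarkovChain : IsMarkovChain searchTree
  searchTree-isMarkovChain = record
    { start∈State = _
    ; p-nonneg    = λ τ σ _ → nonneg τ σ
    ; p-edges     = λ τ σ _ → edges τ σ
    ; p-states    = λ τ σ _ ¬s → contradiction _ ¬s
    ; p-total     = λ τ _ → total τ
    }
    where
    prob : Tree → Tree → ℝ
    prob τ σ = onEdge τ σ (fromℚ (pos 1 ℚ./ branching (size τ)))
    nonneg : ∀ τ σ → 0ℝ ≤ℝ prob τ σ
    nonneg τ σ = if-nonneg {x = fromℚ (pos 1 ℚ./ branching (size τ))} (τ ↗? σ)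
      (fromℚ-nonneg (ℚ.<⇒≤ (1/-pos (branching (size τ)))))
    edges : ∀ τ σ → ¬ (τ ↗ σ) → prob τ σ ≃ 0ℝ
    edges τ σ = if-no (fromℚ (pos 1 ℚ./ branching (size τ))) (τ ↗? σ)
    total : ∀ τ → sumℝ (map (prob τ) (level (size τ))) ≃ 1ℝ
    -- At every index the sum is exactly the number of successors over c(|τ|), which is 1, so 0
    -- serves as threshold.
    total τ ε 0<ε = 0 , λ n _ → subst (λ t → ℚ.∣ t ℚ.- 1ℚ ∣ ℚ.< ε)
      (sym (trans (seq-sum-indicator (τ ↗?_) (level (size τ)) b n)
        (/-≡ (length (successors τ)) b 1 1
          (trans (ℕ.*-identityʳ (length (successors τ))) (trans (length-successors τ) (sym (ℕ.*-identityˡ b)))))))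
      (∣p-p∣<ε 1ℚ 0<ε)
      where
      b : ℕ
      b = branching (size τ)

proposition4p1 : (d : ℕ) (2≤d : 2 ≤ d) → let open DAryTrees d 2≤d in
    (∀ τ → NumberOf (Addable τ) (1 + (d ∸ 1) * size τ))
    × IsMarkovChain searchTree
    × IsMERW searchTree
    × (∀ C → IsMERW C → C ≈ searchTree)
proposition4p1 d 2≤d = addable-count , searchTree-isMarkovChain , searchTree-isMERW , MERW-unique
  where open TreeGrowth d 2≤d
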